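{- Let $n \geq 2$ and let $\mathrm{VG}_n$ be the Varchenko--Gel'fand ring of the braid arrangement $\mathcal{A}_n$, as defined in the context. Then the $\mathfrak{S}_n$-invariant subring satisfies \[ \mathrm{VG}_n^{\mathfrak{S}_n} \cong \mathbb{Q}[z]/\langle z^{n+1}\rangle, \] where $\mathbb{Q}[z]$ is the polynomial ring in one indeterminate $z$.
   Context: For $n \geq 1$, $\mathrm{VG}_n$ is the commutative $\mathbb{Q}$-algebra \[\mathrm{VG}_n = \mathbb{Q}[x_{ij} : 1 \leq i \neq j \leq n+1]\big/\langle x_{ij}^2,\; x_{ij}+x_{ji},\; x_{ij}x_{jk}+x_{jk}x_{ki}+x_{ki}x_{ij}\rangle,\] where the relations range over all distinct $i,j,k \in \{1,\dots,n+1\}$. It is graded with each $x_{ij}$ of degree $1$. The symmetric group $\mathfrak{S}_{n+1}$ acts by ring automorphisms via $\sigma \cdot x_{ij} = x_{\sigma(i)\sigma(j)}$. Here $\mathfrak{S}_n \leq \mathfrak{S}_{n+1}$ denotes the subgroup of permutations fixing $n+1$, and $\mathrm{VG}_n^{\mathfrak{S}_n} = \{x \in \mathrm{VG}_n : \sigma\cdot x = x \text{ for all } \sigma \in \mathfrak{S}_n\}$. -}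

module Defs where

open import Level using (0ℓ)
open import Data.Nat using (ℕ; zero; suc)
open import Data.Fin using (Fin; fromℕ)
open import Data.Fin.Permutation using (Permutation′; _⟨$⟩ʳ_; _⟨$⟩ˡ_; inverseˡ)
open import Data.Rational using (ℚ; 0ℚ; 1ℚ) renaming (_+_ to _+ℚ_; _*_ to _*ℚ_)
open import Data.Unit using (⊤; tt)
open import Data.Product using (Σ; _,_; proj₁; proj₂)
open import Relation.Binary.PropositionalEquality using (_≡_; _≢_; refl; cong; sym; trans)
open import Algebra.Bundles.Raw using (RawRing)

data Term (V : Set) : Set where
  var  : V → Term V
  con  : ℚ → Term V
  _⊕_  : Term V → Term V → Term V
  _⊗_  : Term V → Term V → Term V
  ⊝_   : Term V → Term V

infixl 6 _⊕_
infixl 7 _⊗_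
infix  8 ⊝_

-- Equality in the quotient ℚ[V] / ⟨ Gen ⟩: the smallest congruence
-- containing the commutative-ring axioms, the ring structure of the
-- constants ℚ, and  g ≈ 0  for every ideal generator g.
-- (Term V modulo the ring axioms and constant laws is ℚ[V]; adding g ≈ 0
-- as a congruence gives exactly the quotient by the ideal ⟨Gen⟩.)
module Presentation {V : Set} (Gen : Term V → Set) where

  infix 4 _≈_
  data _≈_ : Term V → Term V → Set where
    ≈-refl  : ∀ {x} → x ≈ x
    ≈-sym   : ∀ {x y} → x ≈ y → y ≈ x
    ≈-trans : ∀ {x y z} → x ≈ y → y ≈ z → x ≈ z
    ⊕-cong  : ∀ {x x′ y y′} → x ≈ x′ → y ≈ y′ → x ⊕ y ≈ x′ ⊕ y′
    ⊗-cong  : ∀ {x x′ y y′} → x ≈ x′ → y ≈ y′ → x ⊗ y ≈ x′ ⊗ y′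
    ⊝-cong  : ∀ {x x′} → x ≈ x′ → ⊝ x ≈ ⊝ x′
    ⊕-assoc : ∀ x y z → (x ⊕ y) ⊕ z ≈ x ⊕ (y ⊕ z)
    ⊕-comm  : ∀ x y → x ⊕ y ≈ y ⊕ x
    ⊕-idˡ   : ∀ x → con 0ℚ ⊕ x ≈ x
    ⊕-invˡ  : ∀ x → (⊝ x) ⊕ x ≈ con 0ℚ
    ⊗-assoc : ∀ x y z → (x ⊗ y) ⊗ z ≈ x ⊗ (y ⊗ z)
    ⊗-comm  : ∀ x y → x ⊗ y ≈ y ⊗ x
    ⊗-idˡ   : ∀ x → con 1ℚ ⊗ x ≈ x
    distribˡ : ∀ x y z → x ⊗ (y ⊕ z) ≈ (x ⊗ y) ⊕ (x ⊗ z)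
    con-+   : ∀ p q → con (p +ℚ q) ≈ con p ⊕ con q
    con-*   : ∀ p q → con (p *ℚ q) ≈ con p ⊗ con q
    gen     : ∀ {g} → Gen g → g ≈ con 0ℚ

  ring : RawRing 0ℓ 0ℓ
  ring = record
    { Carrier = Term V
    ; _≈_ = _≈_
    ; _+_ = _⊕_
    ; _*_ = _⊗_
    ; -_ = ⊝_
    ; 0# = con 0ℚ
    ; 1# = con 1ℚ
    }

-- Index pairs (i , j) with i ≠ j in {1,…,n+1} (here Fin (suc n)).
-- The distinctness proof is irrelevant, so x_ij is determined by (i , j).
record Pair (n : ℕ) : Set where
  field
    fst : Fin (suc n)
    snd : Fin (suc n)
    .distinct : fst ≢ snd

x : ∀ {n} (i j : Fin (suc n)) → .(i ≢ j) → Term (Pair n)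
x i j d = var (record { fst = i ; snd = j ; distinct = d })

data VGGen (n : ℕ) : Term (Pair n) → Set where
  sq   : ∀ i j .(d : i ≢ j) → VGGen n (x i j d ⊗ x i j d)
  anti : ∀ i j .(d : i ≢ j) .(d′ : j ≢ i) → VGGen n (x i j d ⊕ x j i d′)
  tri  : ∀ i j k .(dij : i ≢ j) .(djk : j ≢ k) .(dki : k ≢ i) →
         VGGen n (x i j dij ⊗ x j k djk ⊕ x j k djk ⊗ x k i dki ⊕ x k i dki ⊗ x i j dij)

module VG (n : ℕ) = Presentation (VGGen n)

perm-inj : ∀ {n} (σ : Permutation′ (suc n)) {i j} → σ ⟨$⟩ʳ i ≡ σ ⟨$⟩ʳ j → i ≡ j
perm-inj σ {i} {j} e = trans (sym (inverseˡ σ)) (trans (cong (σ ⟨$⟩ˡ_) e) (inverseˡ σ))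

actPair : ∀ {n} → Permutation′ (suc n) → Pair n → Pair n
actPair σ record { fst = i ; snd = j ; distinct = d } = record
  { fst = σ ⟨$⟩ʳ i ; snd = σ ⟨$⟩ʳ j
  ; distinct = λ e → d (perm-inj σ e) }

act : ∀ {n} → Permutation′ (suc n) → Term (Pair n) → Term (Pair n)
act σ (var p) = var (actPair σ p)
act σ (con q) = con q
act σ (a ⊕ b) = act σ a ⊕ act σ b
act σ (a ⊗ b) = act σ a ⊗ act σ b
act σ (⊝ a)   = ⊝ act σ a

-- 𝔖_n ≤ 𝔖_{n+1}: permutations fixing the last point n+1 (= fromℕ n).
Fixes-last : ∀ {n} → Permutation′ (suc n) → Set
Fixes-last {n} σ = σ ⟨$⟩ʳ fromℕ n ≡ fromℕ n

Invariant : ∀ n → Term (Pair n) → Set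
Invariant n a = ∀ (σ : Permutation′ (suc n)) → Fixes-last σ → VG._≈_ n (act σ a) a

module _ (n : ℕ) where
  open VG n

  private
    Inv : Set
    Inv = Σ (Term (Pair n)) (Invariant n)

  VGInv : RawRing 0ℓ 0ℓ
  VGInv = record
    { Carrier = Inv
    ; _≈_ = λ a b → proj₁ a ≈ proj₁ b
    ; _+_ = λ a b → (proj₁ a ⊕ proj₁ b) , λ σ f → ⊕-cong (proj₂ a σ f) (proj₂ b σ f)
    ; _*_ = λ a b → (proj₁ a ⊗ proj₁ b) , λ σ f → ⊗-cong (proj₂ a σ f) (proj₂ b σ f)
    ; -_ = λ a → (⊝ proj₁ a) , λ σ f → ⊝-cong (proj₂ a σ f)
    ; 0# = con 0ℚ , λ σ f → ≈-refl
    ; 1# = con 1ℚ , λ σ f → ≈-refl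
    }

z : Term ⊤
z = var tt

_^ᵗ_ : Term ⊤ → ℕ → Term ⊤
a ^ᵗ zero  = con 1ℚ
a ^ᵗ suc m = a ⊗ (a ^ᵗ m)

data TruncGen (n : ℕ) : Term ⊤ → Set where
  top : TruncGen n (z ^ᵗ suc n)

Trunc : ℕ → RawRing 0ℓ 0ℓ
Trunc n = Presentation.ring (TruncGen n)

{-# OPTIONS --safe #-}
module Submission where

-- Let Z = Σₐ x_{n+1,a}, a sum of n elements of square zero, so Z^(n+1) = 0; the isomorphism is inverse
-- to z ↦ Z.  It is injective because x_ij ↦ ± e_min(i,j) is a ring map VG_n → ℚ[e₁,…,eₙ]/(eᵢ²)
-- sending Zⁿ to n! e₁⋯eₙ ≠ 0.
--
-- For surjectivity it is enough to show that the sum Sym t over 𝔖_n of the translates of any t is a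
-- polynomial in Z.  Write s ∼ t when Sym s = Sym t.  The relation x_ui x_uj = x_ij x_ui + x_ji x_uj makes
-- every element linear in the variables at a chosen point u, and peeling off points one at a time reduces
-- t to products of path monomials P(v₀,…,v_k) = x_{v₀v₁} x_{v₁v₂} ⋯ x_{v_{k-1}v_k}.  The same relation
-- expands x_{v₀a} P(v₀,…,v_k) as the sum of all insertions of a after v₀, which are ∼ each other.
-- Hence a path of length ≥ 1 avoiding n+1 is ∼ 0 (a positive multiple of it is), while Z times a path
-- starting at n+1 is ∼ a positive multiple of the path one step longer.

open import Defs
open import Level using (0ℓ)
open import Data.Empty using (⊥-elim-irr)
open import Data.Fin using (Fin; zero; suc; fromℕ; punchIn; punchOut)
open import Data.Fin.Permutation as Perm using (Permutation′; _⟨$⟩ʳ_; _⟨$⟩ˡ_; _∘ₚ_; insert; remove; transpose)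
open import Data.Fin.Properties using (_≟_; punchIn-punchOut)
open import Data.List using (List; []; _∷_; length; map; filter; allFin)
open import Data.List.Membership.DecPropositional using () renaming (_∈?_ to member?)
open import Data.List.Membership.Propositional using (_∈_; _∉_)
open import Data.List.Membership.Propositional.Properties using (∈-filter⁺; ∈-filter⁻; ∈-allFin)
open import Data.List.Properties using (map-id-local; filter-notAll)
open import Data.List.Relation.Unary.All as All using (All; []; _∷_)
open import Data.List.Relation.Unary.All.Properties using (¬Any⇒All¬)
open import Data.List.Relation.Unary.AllPairs using ([]; _∷_)
open import Data.List.Relation.Unary.Any as Any using (here; there)
open import Data.List.Relation.Unary.Unique.Propositional using (Unique)
open import Data.Nat as ℕ using (ℕ; zero; suc; _≥_; _≤_; _≤?_; _!)
open import Data.Nat.Properties using (≤-refl; ≤-trans; ≤-pred; ≰⇒>; m∸n+n≡m; 1≤n!)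
open import Data.Product using (∃; _×_; _,_; proj₁; proj₂)
open import Data.Rational as ℚ using (ℚ; 0ℚ; 1ℚ)
import Data.Rational.Properties as ℚₚ
open import Data.Unit using (⊤; tt)
open import Data.Vec.Functional using (removeAt)
open import Function using (_∘_)
open import Relation.Binary.PropositionalEquality as ≡ using (_≡_; _≢_)
open import Relation.Nullary using (Dec; yes; no; ¬?; contradiction)
open import Algebra.Bundles using (CommutativeRing; AbelianGroup)
open import Algebra.Bundles.Raw using (RawRing)
open import Algebra.Morphism.Structures using (module RingMorphisms)
import Algebra.Construct.DirectProduct as DirectProduct
import Algebra.Properties.Ring as RingProperties
import Algebra.Properties.Semiring.Exp as Exp
import Algebra.Properties.Semiring.Mult as Mult
import Algebra.Properties.Semiring.Sum as Sum
import Algebra.Solver.Ring.NaturalCoefficients.Default as SemiringSolver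
import Relation.Binary.Reasoning.Setoid as SetoidReasoning

-- Powers of sums of square-zero elements.

module SquareZero (R : CommutativeRing 0ℓ 0ℓ) where
  open CommutativeRing R hiding (zero)
  open Exp semiring using (_^_)
  open Mult semiring using (×-congʳ; ×-comm-*) renaming (_×_ to _·_)
  open Sum semiring using (sum)
  open SemiringSolver commutativeSemiring
  open SetoidReasoning setoid

  ·-zero : ∀ k {a} → a ≈ 0# → k · a ≈ 0#
  ·-zero zero    a≈0 = refl
  ·-zero (suc k) a≈0 = trans (+-cong a≈0 (·-zero k a≈0)) (+-identityˡ 0#)

  -- As `e` squares to zero, the binomial expansion stops after its linear term in `e`.
  binomial-^ : ∀ {e} → e * e ≈ 0# → ∀ s k →
    (e + s) ^ suc k ≈ s ^ suc k + suc k · (e * s ^ k)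
  binomial-^ {e} e² s zero =
    solve 2 (λ e s → (e :+ s) :* con 1 := s :* con 1 :+ (e :* con 1 :+ con 0)) refl e s
  binomial-^ {e} e² s (suc k) = begin
    (e + s) * (e + s) ^ suc k
      ≈⟨ *-congˡ (binomial-^ e² s k) ⟩
    (e + s) * (s ^ suc k + suc k · (e * s ^ k))
      ≈⟨ distribˡ _ _ _ ⟩
    (e + s) * s ^ suc k + (e + s) * (suc k · (e * s ^ k))
      ≈⟨ +-congˡ (×-comm-* (suc k) _ _) ⟩
    (e + s) * s ^ suc k + suc k · ((e + s) * (e * s ^ k))
      ≈⟨ +-congˡ (×-congʳ (suc k) absorb) ⟩
    (e + s) * s ^ suc k + suc k · (e * s ^ suc k)
      ≈⟨ solve 4 (λ e s p q → (e :+ s) :* p :+ q := s :* p :+ (e :* p :+ q)) refl e s _ _ ⟩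
    s * s ^ suc k + (e * s ^ suc k + suc k · (e * s ^ suc k)) ∎
    where
    absorb : (e + s) * (e * s ^ k) ≈ e * s ^ suc k
    absorb = begin
      (e + s) * (e * s ^ k)
        ≈⟨ solve 3 (λ e s p → (e :+ s) :* (e :* p) := (e :* e) :* p :+ e :* (s :* p)) refl e s _ ⟩
      (e * e) * s ^ k + e * (s * s ^ k)
        ≈⟨ +-congʳ (trans (*-congʳ e²) (zeroˡ _)) ⟩
      0# + e * (s * s ^ k)
        ≈⟨ +-identityˡ _ ⟩
      e * (s * s ^ k) ∎

  -- Induction on `m`: with `s` the sum of all elements but the first, both terms given by
  -- `binomial-^` contain `s ^ suc m`, which is already zero.
  sum-nilpotent : ∀ m (y : Fin m → Carrier) → (∀ i → y i * y i ≈ 0#) → sum y ^ suc m ≈ 0#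
  sum-nilpotent zero    y y² = zeroˡ _
  sum-nilpotent (suc m) y y² = begin
    sum y ^ suc (suc m)                          ≈⟨ binomial-^ (y² zero) s (suc m) ⟩
    s * s ^ suc m + suc (suc m) · (y zero * s ^ suc m)
      ≈⟨ +-cong (trans (*-congˡ ih) (zeroʳ _)) (·-zero (suc (suc m)) (trans (*-congˡ ih) (zeroʳ _))) ⟩
    0# + 0#                                      ≈⟨ +-identityˡ _ ⟩
    0#                                           ∎
    where
    s = sum (y ∘ suc)
    ih = sum-nilpotent m (y ∘ suc) (y² ∘ suc)

-- Dual numbers over a commutative ring.

module DualNumbers (R : CommutativeRing 0ℓ 0ℓ) where
  open CommutativeRing R
  open SemiringSolver commutativeSemiring
  private
    module P = AbelianGroup (DirectProduct.abelianGroup +-abelianGroup +-abelianGroup)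

  -- The pair `(a , b)` stands for a + b ε with ε² = 0.
  dualNumbers : CommutativeRing 0ℓ 0ℓ
  dualNumbers = record
    { Carrier = Carrier × Carrier
    ; _≈_ = P._≈_
    ; _+_ = P._∙_
    ; _*_ = λ (a , b) (c , d) → a * c , a * d + b * c
    ; -_ = P._⁻¹
    ; 0# = P.ε
    ; 1# = 1# , 0#
    ; isCommutativeRing = record
      { isRing = record
        { +-isAbelianGroup = P.isAbelianGroup
        ; *-cong = λ (p , p′) (q , q′) → *-cong p q , +-cong (*-cong p q′) (*-cong p′ q)
        ; *-assoc = λ (a , b) (c , d) (e , f) → *-assoc a c e ,
            solve 6 (λ a b c d e f → (a :* c) :* f :+ (a :* d :+ b :* c) :* e
                                  := a :* (c :* f :+ d :* e) :+ b :* (c :* e)) refl a b c d e f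
        ; *-identity =
            (λ (a , b) → *-identityˡ a ,
              solve 2 (λ a b → con 1 :* b :+ con 0 :* a := b) refl a b) ,
            (λ (a , b) → *-identityʳ a ,
              solve 2 (λ a b → a :* con 0 :+ b :* con 1 := b) refl a b)
        ; distrib =
            (λ (a , b) (c , d) (e , f) → distribˡ a c e ,
              solve 6 (λ a b c d e f → a :* (d :+ f) :+ b :* (c :+ e)
                := (a :* d :+ b :* c) :+ (a :* f :+ b :* e)) refl a b c d e f) ,
            (λ (a , b) (c , d) (e , f) → distribʳ a c e ,
              solve 6 (λ a b c d e f → (c :+ e) :* b :+ (d :+ f) :* a
                := (c :* b :+ d :* a) :+ (e :* b :+ f :* a)) refl a b c d e f)
        }
      ; *-comm = λ (a , b) (c , d) → *-comm a c ,
          solve 4 (λ a b c d → a :* d :+ b :* c := c :* b :+ d :* a) refl a b c d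
      }
    }

-- Presented rings, ℚ-algebras and evaluation of terms.

module PresentedRing {V : Set} (Gen : Term V → Set) where
  open Presentation Gen

  commutativeRing : CommutativeRing 0ℓ 0ℓ
  commutativeRing = record
    { RawRing′
    ; isCommutativeRing = record
      { isRing = record
        { +-isAbelianGroup = record
          { isGroup = record
            { isMonoid = record
              { isSemigroup = record
                { isMagma = record
                  { isEquivalence = record { refl = ≈-refl ; sym = ≈-sym ; trans = ≈-trans }
                  ; ∙-cong = ⊕-cong }
                ; assoc = ⊕-assoc }
              ; identity = ⊕-idˡ , λ a → ≈-trans (⊕-comm _ _) (⊕-idˡ a) }
            ; inverse = ⊕-invˡ , λ a → ≈-trans (⊕-comm _ _) (⊕-invˡ a)
            ; ⁻¹-cong = ⊝-cong }
          ; comm = ⊕-comm }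
        ; *-cong = ⊗-cong
        ; *-assoc = ⊗-assoc
        ; *-identity = ⊗-idˡ , λ a → ≈-trans (⊗-comm _ _) (⊗-idˡ a)
        ; distrib = distribˡ , λ a b c → ≈-trans (⊗-comm _ _)
            (≈-trans (distribˡ a b c) (⊕-cong (⊗-comm _ _) (⊗-comm _ _))) }
      ; *-comm = ⊗-comm }
    }
    where module RawRing′ = RawRing ring

record ℚ-Algebra : Set₁ where
  field
    commutativeRing : CommutativeRing 0ℓ 0ℓ
  open CommutativeRing commutativeRing public
  field
    κ   : ℚ → Carrier
    κ-0 : κ 0ℚ ≈ 0#
    κ-1 : κ 1ℚ ≈ 1#
    κ-+ : ∀ p q → κ (p ℚ.+ q) ≈ κ p + κ q
    κ-* : ∀ p q → κ (p ℚ.* q) ≈ κ p * κ q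

presented : {V : Set} (Gen : Term V → Set) → ℚ-Algebra
presented Gen = record
  { commutativeRing = PresentedRing.commutativeRing Gen
  ; κ = con
  ; κ-0 = ≈-refl
  ; κ-1 = ≈-refl
  ; κ-+ = con-+
  ; κ-* = con-* }
  where open Presentation Gen

module Evaluation {V : Set} (A : ℚ-Algebra) (ρ : V → ℚ-Algebra.Carrier A) where
  open ℚ-Algebra A hiding (distribˡ)

  ⟦_⟧ : Term V → Carrier
  ⟦ var v ⟧ = ρ v
  ⟦ con q ⟧ = κ q
  ⟦ s ⊕ t ⟧ = ⟦ s ⟧ + ⟦ t ⟧
  ⟦ s ⊗ t ⟧ = ⟦ s ⟧ * ⟦ t ⟧
  ⟦ ⊝ t ⟧   = - ⟦ t ⟧

  module _ {Gen : Term V → Set} (vanish : ∀ {g} → Gen g → ⟦ g ⟧ ≈ 0#) where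
    open Presentation Gen renaming (_≈_ to _≈ᵖ_)

    -- The universal property of the quotient. It serves three times: for the action of a
    -- permutation, for the map to the model `D n`, and for evaluation at `Z`.
    ⟦⟧-cong : ∀ {s t} → s ≈ᵖ t → ⟦ s ⟧ ≈ ⟦ t ⟧
    ⟦⟧-cong ≈-refl          = refl
    ⟦⟧-cong (≈-sym p)       = sym (⟦⟧-cong p)
    ⟦⟧-cong (≈-trans p q)   = trans (⟦⟧-cong p) (⟦⟧-cong q)
    ⟦⟧-cong (⊕-cong p q)    = +-cong (⟦⟧-cong p) (⟦⟧-cong q)
    ⟦⟧-cong (⊗-cong p q)    = *-cong (⟦⟧-cong p) (⟦⟧-cong q)
    ⟦⟧-cong (⊝-cong p)      = -‿cong (⟦⟧-cong p)
    ⟦⟧-cong (⊕-assoc s t u) = +-assoc _ _ _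
    ⟦⟧-cong (⊕-comm s t)    = +-comm _ _
    ⟦⟧-cong (⊕-idˡ s)       = trans (+-congʳ κ-0) (+-identityˡ _)
    ⟦⟧-cong (⊕-invˡ s)      = trans (-‿inverseˡ _) (sym κ-0)
    ⟦⟧-cong (⊗-assoc s t u) = *-assoc _ _ _
    ⟦⟧-cong (⊗-comm s t)    = *-comm _ _
    ⟦⟧-cong (⊗-idˡ s)       = trans (*-congʳ κ-1) (*-identityˡ _)
    ⟦⟧-cong (distribˡ s t u) = ℚ-Algebra.distribˡ A _ _ _
    ⟦⟧-cong (con-+ p q)     = κ-+ p q
    ⟦⟧-cong (con-* p q)     = κ-* p q
    ⟦⟧-cong (gen g)         = trans (vanish g) (sym κ-0)

-- Division by positive integers.

ℕ→ℚ : ℕ → ℚ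
ℕ→ℚ zero    = 0ℚ
ℕ→ℚ (suc k) = 1ℚ ℚ.+ ℕ→ℚ k

ℕ→ℚ-nonNegative : ∀ k → 0ℚ ℚ.≤ ℕ→ℚ k
ℕ→ℚ-nonNegative zero    = ℚₚ.≤-refl
ℕ→ℚ-nonNegative (suc k) = ℚₚ.+-mono-≤ (ℚₚ.nonNegative⁻¹ 1ℚ) (ℕ→ℚ-nonNegative k)

ℕ→ℚ-suc-nonZero : ∀ k → ℚ.NonZero (ℕ→ℚ (suc k))
ℕ→ℚ-suc-nonZero k = ℚ.≢-nonZero λ e →
  ℚₚ.<⇒≢ (ℚₚ.+-mono-<-≤ (ℚₚ.positive⁻¹ 1ℚ) (ℕ→ℚ-nonNegative k)) (≡.sym e)

recip : ℕ → ℚ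
recip k = ℚ.1/_ (ℕ→ℚ (suc k)) {{ℕ→ℚ-suc-nonZero k}}

recip-inverse : ∀ k → recip k ℚ.* ℕ→ℚ (suc k) ≡ 1ℚ
recip-inverse k = ℚₚ.*-inverseˡ (ℕ→ℚ (suc k)) {{ℕ→ℚ-suc-nonZero k}}

module Division (A : ℚ-Algebra) where
  open ℚ-Algebra A hiding (zero)
  open Mult semiring using () renaming (_×_ to _·_)
  open SetoidReasoning setoid

  κ-ℕ : ∀ k a → κ (ℕ→ℚ k) * a ≈ k · a
  κ-ℕ zero    a = trans (*-congʳ κ-0) (zeroˡ a)
  κ-ℕ (suc k) a = begin
    κ (1ℚ ℚ.+ ℕ→ℚ k) * a       ≈⟨ *-congʳ (trans (κ-+ _ _) (+-congʳ κ-1)) ⟩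
    (1# + κ (ℕ→ℚ k)) * a       ≈⟨ distribʳ _ _ _ ⟩
    1# * a + κ (ℕ→ℚ k) * a     ≈⟨ +-cong (*-identityˡ a) (κ-ℕ k a) ⟩
    a + k · a                  ∎

  -- The arguments with paths and with symmetrisation determine elements only up to a positive
  -- integer factor, which is removed here.
  divide : ∀ k {a b} → suc k · a ≈ b → a ≈ κ (recip k) * b
  divide k {a} {b} e = begin
    a                                       ≈⟨ *-identityˡ a ⟨
    1# * a                                  ≈⟨ *-congʳ κ-1 ⟨
    κ 1ℚ * a                                ≡⟨ ≡.cong (λ q → κ q * a) (recip-inverse k) ⟨
    κ (recip k ℚ.* ℕ→ℚ (suc k)) * a         ≈⟨ *-congʳ (κ-* _ _) ⟩
    κ (recip k) * κ (ℕ→ℚ (suc k)) * a       ≈⟨ *-assoc _ _ _ ⟩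
    κ (recip k) * (κ (ℕ→ℚ (suc k)) * a)     ≈⟨ *-congˡ (trans (κ-ℕ (suc k) a) e) ⟩
    κ (recip k) * b                         ∎

  torsion-free : ∀ k {a} → suc k · a ≈ 0# → a ≈ 0#
  torsion-free k e = trans (divide k e) (zeroʳ _)

-- The model with square-zero generators.

ℚ-algebra : ℚ-Algebra
ℚ-algebra = record
  { commutativeRing = ℚₚ.+-*-commutativeRing
  ; κ = λ q → q ; κ-0 = ≡.refl ; κ-1 = ≡.refl ; κ-+ = λ _ _ → ≡.refl ; κ-* = λ _ _ → ≡.refl }

dualAlgebra : ℚ-Algebra → ℚ-Algebra
dualAlgebra A = record
  { commutativeRing = DualNumbers.dualNumbers commutativeRing
  ; κ = λ q → κ q , 0#
  ; κ-0 = κ-0 , refl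
  ; κ-1 = κ-1 , refl
  ; κ-+ = λ p q → κ-+ p q , sym (+-identityˡ 0#)
  ; κ-* = λ p q → κ-* p q , sym (trans (+-cong (zeroʳ _) (zeroˡ _)) (+-identityˡ 0#)) }
  where open ℚ-Algebra A

-- D n = ℚ[e₁,…,eₙ]/(e₁²,…,eₙ²)
D : ℕ → ℚ-Algebra
D zero    = ℚ-algebra
D (suc n) = dualAlgebra (D n)

-- x_ij ↦ ± e_min(i,j), induced by the planetary systems (S²)ⁿ → Conf_{n+1}(ℝ³) whose innermost body is n+1.
ψ : ∀ n → Fin (suc n) → Fin (suc n) → ℚ-Algebra.Carrier (D n)
ψ zero    _       _       = 0ℚ
ψ (suc n) zero    zero    = ℚ-Algebra.0# (D (suc n))
ψ (suc n) zero    (suc j) = ℚ-Algebra.-_ (D (suc n)) (ℚ-Algebra.0# (D n) , ℚ-Algebra.1# (D n))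
ψ (suc n) (suc i) zero    = ℚ-Algebra.0# (D n) , ℚ-Algebra.1# (D n)
ψ (suc n) (suc i) (suc j) = ψ n i j , ℚ-Algebra.0# (D n)

module _ (A : ℚ-Algebra) where
  open ℚ-Algebra A
  open SemiringSolver commutativeSemiring
  open Exp (ℚ-Algebra.semiring (dualAlgebra A)) using () renaming (_^_ to _^ᴰ_)
  open Exp semiring using (_^_)
  open Mult (ℚ-Algebra.semiring (dualAlgebra A)) using () renaming (_×_ to _·ᴰ_)
  open Mult semiring using () renaming (_×_ to _·_)
  open Sum (ℚ-Algebra.semiring (dualAlgebra A)) using () renaming (sum to sumᴰ)
  open Sum semiring using (sum)
  private module Dual = ℚ-Algebra (dualAlgebra A)

  ε²≈0 : (0# , 1#) Dual.* (0# , 1#) Dual.≈ Dual.0#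
  ε²≈0 = zeroˡ 0# , solve 0 (con 0 :* con 1 :+ con 1 :* con 0 := con 0) refl

  -- The prefix `ι` refers to the inclusion `a ↦ (a , 0#)` of `A` into its dual numbers.
  ι-sum : ∀ {m} (f : Fin m → Carrier) → sumᴰ (λ i → f i , 0#) Dual.≈ (sum f , 0#)
  ι-sum {ℕ.zero} f = Dual.refl
  ι-sum {suc m}  f = Dual.trans (Dual.+-congˡ (ι-sum (f ∘ suc))) (refl , +-identityˡ 0#)

  ι-^ : ∀ s k → (s , 0#) ^ᴰ k Dual.≈ (s ^ k , 0#)
  ι-^ s ℕ.zero  = Dual.refl
  ι-^ s (suc k) = Dual.trans (Dual.*-congˡ (ι-^ s k))
    (refl , trans (+-cong (zeroʳ _) (zeroˡ _)) (+-identityˡ 0#))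

  proj₂-· : ∀ k a → proj₂ (k ·ᴰ a) ≡ k · proj₂ a
  proj₂-· ℕ.zero  a = ≡.refl
  proj₂-· (suc k) a = ≡.cong (proj₂ a +_) (proj₂-· k a)

  ι-tri : ∀ a b c → a * b + b * c + c * a ≈ 0# →
    (a , 0#) Dual.* (b , 0#) Dual.+ (b , 0#) Dual.* (c , 0#) Dual.+ (c , 0#) Dual.* (a , 0#) Dual.≈ Dual.0#
  ι-tri a b c e = e ,
    solve 3 (λ a b c → (a :* con 0 :+ con 0 :* b) :+ (b :* con 0 :+ con 0 :* c) :+ (c :* con 0 :+ con 0 :* a)
                     := con 0) refl a b c

module _ (A : ℚ-Algebra) where
  open ℚ-Algebra A
  open RingProperties ring using (-‿distribˡ-*; -‿distribʳ-*; -0#≈0#)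

  module _ {e : Carrier} (e² : e * e ≈ 0#) where

    -e*e≈0 : - e * e ≈ 0#
    -e*e≈0 = trans (sym (-‿distribˡ-* e e)) (trans (-‿cong e²) -0#≈0#)

    -e*-e≈0 : - e * - e ≈ 0#
    -e*-e≈0 = trans (sym (-‿distribʳ-* (- e) e)) (trans (-‿cong -e*e≈0) -0#≈0#)

    -- A triangle at the vertex of smallest index: the two edges there carry `- e` and `e`, and `p`
    -- is the opposite edge. The terms with `p` cancel, and the third contains e².
    square-zero-tri : ∀ p → - e * p + p * e + e * - e ≈ 0#
    square-zero-tri p = trans
      (+-cong (trans (+-cong (sym (-‿distribˡ-* e p)) (*-comm p e)) (-‿inverseˡ _))
              (trans (*-comm _ _) -e*e≈0))
      (+-identityˡ 0#)

  rotate : ∀ {a b c} → a + b + c ≈ 0# → c + a + b ≈ 0#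
  rotate s = trans (trans (+-assoc _ _ _) (+-comm _ _)) s

ψ-diag : ∀ n i → let open ℚ-Algebra (D n) in ψ n i i ≈ 0#
ψ-diag zero    i       = ≡.refl
ψ-diag (suc n) zero    = ℚ-Algebra.refl (D (suc n))
ψ-diag (suc n) (suc i) = ψ-diag n i , ℚ-Algebra.refl (D n)

ψ-sq : ∀ n i j → let open ℚ-Algebra (D n) in ψ n i j * ψ n i j ≈ 0#
ψ-sq zero    i       j       = ≡.refl
ψ-sq (suc n) zero    zero    = ℚ-Algebra.zeroˡ (D (suc n)) _
ψ-sq (suc n) zero    (suc j) = -e*-e≈0 (D (suc n)) (ε²≈0 (D n))
ψ-sq (suc n) (suc i) zero    = ε²≈0 (D n)
ψ-sq (suc n) (suc i) (suc j) = ψ-sq n i j , trans (+-cong (zeroʳ _) (zeroˡ _)) (+-identityˡ _)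
  where open ℚ-Algebra (D n)

ψ-anti : ∀ n i j → let open ℚ-Algebra (D n) in ψ n i j + ψ n j i ≈ 0#
ψ-anti zero    i       j       = ≡.refl
ψ-anti (suc n) zero    zero    = ℚ-Algebra.+-identityˡ (D (suc n)) _
ψ-anti (suc n) zero    (suc j) = ℚ-Algebra.-‿inverseˡ (D (suc n)) _
ψ-anti (suc n) (suc i) zero    = ℚ-Algebra.-‿inverseʳ (D (suc n)) _
ψ-anti (suc n) (suc i) (suc j) = ψ-anti n i j , ℚ-Algebra.+-identityˡ (D n) _

-- A triangle through `zero` is a rotation of `square-zero-tri`; one that avoids `zero` comes from
-- `D n` along `ι-tri`.
ψ-tri : ∀ n i j k → .(i ≢ j) → .(j ≢ k) → .(k ≢ i) → let open ℚ-Algebra (D n) in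
  ψ n i j * ψ n j k + ψ n j k * ψ n k i + ψ n k i * ψ n i j ≈ 0#
ψ-tri zero    i       j       k       _   _   _   = ≡.refl
ψ-tri (suc n) zero    zero    k       i≢j _   _   = ⊥-elim-irr (i≢j ≡.refl)
ψ-tri (suc n) zero    (suc j) zero    _   _   k≢i = ⊥-elim-irr (k≢i ≡.refl)
ψ-tri (suc n) (suc i) zero    zero    _   j≢k _   = ⊥-elim-irr (j≢k ≡.refl)
ψ-tri (suc n) zero    (suc j) (suc k) _   _   _   = square-zero-tri (D (suc n)) (ε²≈0 (D n)) (ψ (suc n) (suc j) (suc k))
ψ-tri (suc n) (suc i) zero    (suc k) _   _   _   = rotate (D (suc n))
  (square-zero-tri (D (suc n)) (ε²≈0 (D n)) (ψ (suc n) (suc k) (suc i)))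
ψ-tri (suc n) (suc i) (suc j) zero    _   _   _   = rotate (D (suc n)) (rotate (D (suc n))
  (square-zero-tri (D (suc n)) (ε²≈0 (D n)) (ψ (suc n) (suc i) (suc j))))
ψ-tri (suc n) (suc i) (suc j) (suc k) i≢j j≢k k≢i = ι-tri (D n) _ _ _
  (ψ-tri n i j k (λ { ≡.refl → i≢j ≡.refl }) (λ { ≡.refl → j≢k ≡.refl }) (λ { ≡.refl → k≢i ≡.refl }))

module _ (n : ℕ) where
  open ℚ-Algebra (D n)
  open Exp semiring using (_^_)
  open Sum semiring using (sum)

  -- The image of `Z` in the model. As `fromℕ n` is the largest index, the minimum is always the
  -- other index and every sign is positive, so this is e₁ + ⋯ + eₙ.
  ζ : Carrier
  ζ = sum (ψ n (fromℕ n))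

  ζⁿ : Carrier
  ζⁿ = ζ ^ n

-- `ζ (suc n)` is `ζ n` plus a new square-zero generator, so `binomial-^` applies, and the second
-- component reads off the coefficient of that generator. Iterated, this gives n! as the coefficient
-- of e₁⋯eₙ in ζⁿ.
ζⁿ-suc : ∀ n → let open ℚ-Algebra (D n); open Mult semiring renaming (_×_ to _·_) in
  proj₂ (ζⁿ (suc n)) ≈ suc n · ζⁿ n
ζⁿ-suc n = begin
  proj₂ (ζ (suc n) ^ suc n)
    ≈⟨ proj₂ (^-congˡ (suc n) (Dual.+-congˡ {e} (ι-sum (D n) (ψ n (fromℕ n))))) ⟩
  proj₂ ((e Dual.+ ιζ) ^ suc n)
    ≈⟨ proj₂ (SquareZero.binomial-^ Dual.commutativeRing (ε²≈0 (D n)) ιζ n) ⟩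
  proj₂ (ιζ ^ suc n) + proj₂ (suc n ·ᴰ (e Dual.* ιζ ^ n))
    ≈⟨ +-cong (proj₂ (ι-^ (D n) (ζ n) (suc n))) (reflexive (proj₂-· (D n) (suc n) (e Dual.* ιζ ^ n))) ⟩
  0# + suc n · proj₂ (e Dual.* ιζ ^ n)
    ≈⟨ +-identityˡ _ ⟩
  suc n · proj₂ (e Dual.* ιζ ^ n)
    ≈⟨ ×-congʳ (suc n) (trans (proj₂ (Dual.*-congˡ {e} (ι-^ (D n) (ζ n) n)))
         (trans (+-cong (zeroˡ _) (*-identityˡ _)) (+-identityˡ _))) ⟩
  suc n · ζⁿ n ∎
  where
  open ℚ-Algebra (D n)
  module Dual = ℚ-Algebra (D (suc n))
  open Exp Dual.semiring using (_^_; ^-congˡ)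
  open Mult Dual.semiring using () renaming (_×_ to _·ᴰ_)
  open Mult semiring using (×-congʳ) renaming (_×_ to _·_)
  open SetoidReasoning setoid
  e ιζ : Dual.Carrier
  e = 0# , 1#
  ιζ = ζ n , 0#

-- Each second component strips one generator at the cost of a factor `suc n`, which `torsion-free`
-- cancels. For `n = 0` the power is 1.
ζⁿ-free : ∀ n c → let open ℚ-Algebra (D n) in κ c * ζⁿ n ≈ 0# → c ≡ 0ℚ
ζⁿ-free zero    c e = ≡.trans (≡.sym (ℚₚ.*-identityʳ c)) e
ζⁿ-free (suc n) c e = ζⁿ-free n c (Division.torsion-free (D n) n (begin
  suc n · (κ c * ζⁿ n)            ≈⟨ ×-comm-* (suc n) _ _ ⟨
  κ c * (suc n · ζⁿ n)            ≈⟨ *-congˡ (ζⁿ-suc n) ⟨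
  κ c * proj₂ (ζⁿ (suc n))        ≈⟨ +-identityʳ _ ⟨
  κ c * proj₂ (ζⁿ (suc n)) + 0#   ≈⟨ +-congˡ (zeroˡ _) ⟨
  κ c * proj₂ (ζⁿ (suc n)) + 0# * proj₁ (ζⁿ (suc n)) ≈⟨ proj₂ e ⟩
  0#                              ∎))
  where
  open ℚ-Algebra (D n)
  open Mult semiring using (×-comm-*) renaming (_×_ to _·_)
  open SetoidReasoning setoid

-- Sums over a symmetric group.

insert-self : ∀ {m} i k (π : Permutation′ m) → insert i k π ⟨$⟩ʳ i ≡ k
insert-self i k π with i ≟ i
... | yes _  = ≡.refl
... | no i≢i = contradiction ≡.refl i≢i

insert-cong : ∀ {m} i k {π ρ : Permutation′ m} → π Perm.≈ ρ → insert i k π Perm.≈ insert i k ρ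
insert-cong i k π≈ρ l with i ≟ l
... | yes _  = ≡.refl
... | no i≢l = ≡.cong (punchIn k) (π≈ρ (punchOut i≢l))

-- Both sides send `i` to `k`. On the other points, `remove i τ` is the bijection that `τ` induces
-- from the complement of `i` to that of `j`.
∘-insert : ∀ {m} (τ : Permutation′ (suc m)) {i j} → τ ⟨$⟩ʳ i ≡ j → ∀ k (π : Permutation′ m) →
  τ ∘ₚ insert j k π Perm.≈ insert i k (remove i τ ∘ₚ π)
∘-insert τ {i} ≡.refl k π l with i ≟ l
... | yes ≡.refl = insert-self (τ ⟨$⟩ʳ i) k π
... | no i≢l = begin
  insert j k π ⟨$⟩ʳ (τ ⟨$⟩ʳ l)
    ≡⟨ ≡.cong (λ l → insert j k π ⟨$⟩ʳ (τ ⟨$⟩ʳ l)) (punchIn-punchOut i≢l) ⟨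
  insert j k π ⟨$⟩ʳ (τ ⟨$⟩ʳ punchIn i (punchOut i≢l))
    ≡⟨ ≡.cong (insert j k π ⟨$⟩ʳ_) (Perm.punchIn-permute τ i (punchOut i≢l)) ⟩
  insert j k π ⟨$⟩ʳ punchIn j (remove i τ ⟨$⟩ʳ punchOut i≢l)
    ≡⟨ Perm.insert-punchIn j k π _ ⟩
  punchIn k (π ⟨$⟩ʳ (remove i τ ⟨$⟩ʳ punchOut i≢l)) ∎
  where
  open ≡.≡-Reasoning
  j = τ ⟨$⟩ʳ i

module PermutationSum (R : CommutativeRing 0ℓ 0ℓ) where
  open CommutativeRing R hiding (zero)
  open Sum semiring
  open Mult semiring using (×-assocˡ) renaming (_×_ to _·_)

  -- Every permutation of `Fin (suc m)` is `insert j zero π` for exactly one preimage `j` of `zero`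
  -- and one `π`, up to pointwise equality, so the recursion meets each permutation once.
  ∑ₚ : ∀ m → (Permutation′ m → Carrier) → Carrier
  ∑ₚ zero    F = F Perm.id
  ∑ₚ (suc m) F = ∑[ j < suc m ] ∑ₚ m (λ π → F (insert j zero π))

  ∑ₚ-cong : ∀ m {F G : Permutation′ m → Carrier} → (∀ π → F π ≈ G π) → ∑ₚ m F ≈ ∑ₚ m G
  ∑ₚ-cong zero    F≈G = F≈G Perm.id
  ∑ₚ-cong (suc m) F≈G = sum-cong-≋ {suc m} λ j → ∑ₚ-cong m λ π → F≈G (insert j zero π)

  ∑ₚ-+ : ∀ m (F G : Permutation′ m → Carrier) → ∑ₚ m (λ π → F π + G π) ≈ ∑ₚ m F + ∑ₚ m G
  ∑ₚ-+ zero    F G = refl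
  ∑ₚ-+ (suc m) F G = trans (sum-cong-≋ {suc m} λ j → ∑ₚ-+ m (F ∘ insert j zero) (G ∘ insert j zero))
    (∑-distrib-+ {suc m} (λ j → ∑ₚ m (F ∘ insert j zero)) (λ j → ∑ₚ m (G ∘ insert j zero)))

  ∑ₚ-* : ∀ m a (F : Permutation′ m → Carrier) → ∑ₚ m (λ π → a * F π) ≈ a * ∑ₚ m F
  ∑ₚ-* zero    a F = refl
  ∑ₚ-* (suc m) a F = trans (sum-cong-≋ {suc m} λ j → ∑ₚ-* m a (F ∘ insert j zero))
    (sym (*-distribˡ-sum {suc m} a (λ j → ∑ₚ m (F ∘ insert j zero))))

  ∑ₚ-const : ∀ m a → ∑ₚ m (λ _ → a) ≈ (m !) · a
  ∑ₚ-const zero    a = sym (+-identityʳ a)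
  ∑ₚ-const (suc m) a = trans (sum-cong-≋ {suc m} λ _ → ∑ₚ-const m a)
    (trans (sum-replicate (suc m)) (×-assocˡ a (suc m) (m !)))

  -- By `∘-insert`, composing with `τ` moves the outer index `j` to its preimage under `τ`, undone
  -- by reindexing the outer sum, and composes the inner permutation with a removal of `τ`, absorbed
  -- by induction.
  ∑ₚ-∘ : ∀ m (F : Permutation′ m → Carrier) → (∀ π ρ → π Perm.≈ ρ → F π ≈ F ρ) →
    ∀ τ → ∑ₚ m (λ π → F (τ ∘ₚ π)) ≈ ∑ₚ m F
  ∑ₚ-∘ zero    F resp τ = resp _ _ λ ()
  ∑ₚ-∘ (suc m) F resp τ = begin
    ∑[ j < suc m ] ∑ₚ m (λ π → F (τ ∘ₚ insert j zero π))
      ≈⟨ sum-cong-≋ {suc m} (λ j → ∑ₚ-cong m λ π →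
           resp (τ ∘ₚ insert j zero π) (insert (τ⁻¹ j) zero (remove (τ⁻¹ j) τ ∘ₚ π))
             (∘-insert τ {τ⁻¹ j} {j} (Perm.inverseʳ τ) zero π)) ⟩
    ∑[ j < suc m ] ∑ₚ m (λ π → F (insert (τ⁻¹ j) zero (remove (τ⁻¹ j) τ ∘ₚ π)))
      ≈⟨ sum-cong-≋ {suc m} (λ j → ∑ₚ-∘ m (λ π → F (insert (τ⁻¹ j) zero π))
           (λ π ρ e → resp (insert (τ⁻¹ j) zero π) (insert (τ⁻¹ j) zero ρ)
             (insert-cong (τ⁻¹ j) zero {π} {ρ} e)) (remove (τ⁻¹ j) τ)) ⟩
    ∑[ j < suc m ] ∑ₚ m (λ π → F (insert (τ⁻¹ j) zero π))
      ≈⟨ sum-permute (λ j → ∑ₚ m (λ π → F (insert j zero π))) (Perm.flip τ) ⟨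
    ∑[ j < suc m ] ∑ₚ m (λ π → F (insert j zero π)) ∎
    where
    open SetoidReasoning setoid
    τ⁻¹ : Fin (suc m) → Fin (suc m)
    τ⁻¹ = τ ⟨$⟩ˡ_

-- Consequences of the defining relations.

VG-algebra : ℕ → ℚ-Algebra
VG-algebra n = presented (VGGen n)

module Relations (n : ℕ) where
  open ℚ-Algebra (VG-algebra n) hiding (zero)
  open Presentation (VGGen n) using (gen)
  open RingProperties ring using (-‿distribʳ-*; -0#≈0#; +-inverseˡ-unique)
  open SemiringSolver commutativeSemiring
  open SetoidReasoning setoid

  -- The generator x_ij extended by x_ii = 0; all defining relations persist.
  X : Fin (suc n) → Fin (suc n) → Carrier
  X i j with i ≟ j
  ... | yes _ = 0#
  ... | no d  = x i j d

  X-diag : ∀ i → X i i ≡ 0#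
  X-diag i with i ≟ i
  ... | yes _ = ≡.refl
  ... | no d  = contradiction ≡.refl d

  X-x : ∀ i j .(d : i ≢ j) → X i j ≡ x i j d
  X-x i j d with i ≟ j
  ... | yes e = ⊥-elim-irr (d e)
  ... | no _  = ≡.refl

  X-sq : ∀ i j → X i j * X i j ≈ 0#
  X-sq i j with i ≟ j
  ... | yes _ = zeroˡ _
  ... | no d  = gen (sq i j d)

  X-anti : ∀ i j → X i j + X j i ≈ 0#
  X-anti i j with i ≟ j
  ... | yes ≡.refl = trans (+-identityˡ _) (reflexive (X-diag i))
  ... | no d = trans (+-congˡ (reflexive (X-x j i (d ∘ ≡.sym)))) (gen (anti i j d (d ∘ ≡.sym)))

  X-flip : ∀ i j → X i j ≈ - X j i
  X-flip i j = +-inverseˡ-unique _ _ (X-anti i j)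

  X-sq′ : ∀ i j → X i j * X j i ≈ 0#
  X-sq′ i j = begin
    X i j * X j i      ≈⟨ *-congˡ (X-flip j i) ⟩
    X i j * - X i j    ≈⟨ -‿distribʳ-* _ _ ⟨
    - (X i j * X i j)  ≈⟨ -‿cong (X-sq i j) ⟩
    - 0#               ≈⟨ -0#≈0# ⟩
    0#                 ∎

  X-tri : ∀ i j k → X i j * X j k + X j k * X k i + X k i * X i j ≈ 0#
  X-tri i j k = go (i ≟ j) (j ≟ k) (k ≟ i)
    where
    -- A repeated index leaves a single product X a b * X b a.
    degenerate : ∀ {a b c} → a ≈ 0# → b * c ≈ 0# → a * b + b * c + c * a ≈ 0#
    degenerate {a} {b} {c} a≈0 bc≈0 = begin
      a * b + b * c + c * a ≈⟨ +-cong (+-cong (*-congʳ a≈0) bc≈0) (*-congˡ a≈0) ⟩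
      0# * b + 0# + c * 0#  ≈⟨ solve 2 (λ b c → con 0 :* b :+ con 0 :+ c :* con 0 := con 0) refl b c ⟩
      0#                    ∎

    go : Dec (i ≡ j) → Dec (j ≡ k) → Dec (k ≡ i) →
      X i j * X j k + X j k * X k i + X k i * X i j ≈ 0#
    go (yes ≡.refl) _ _ = degenerate (reflexive (X-diag i)) (X-sq′ i k)
    go (no _) (yes ≡.refl) _ = rotate (VG-algebra n) (degenerate (reflexive (X-diag j)) (X-sq′ j i))
    go (no _) (no _) (yes ≡.refl) =
      rotate (VG-algebra n) (rotate (VG-algebra n) (degenerate (reflexive (X-diag i)) (X-sq′ i j)))
    go (no d) (no e) (no f)
      rewrite X-x i j d | X-x j k e | X-x k i f = gen (tri i j k d e f)

  -- The triangle relation with all edges at `u` pointing outwards. It trades two edges at `u` for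
  -- one, which drives both the insertion formula for paths and the linearity in the variables at
  -- `u`.
  star : ∀ u i j → X u i * X u j ≈ X i j * X u i + X j i * X u j
  star u i j = begin
    r * q                                ≈⟨ +-identityʳ _ ⟨
    r * q + 0#                           ≈⟨ +-congˡ (X-tri i j u) ⟨
    r * q + (p * q′ + q′ * r + r * p)
      ≈⟨ solve 4 (λ p q q′ r → r :* q :+ (p :* q′ :+ q′ :* r :+ r :* p) := (q :+ q′) :* r :+ (p :* r :+ p :* q′)) refl p q q′ r ⟩
    (q + q′) * r + (p * r + p * q′)      ≈⟨ +-congʳ (trans (*-congʳ (X-anti u j)) (zeroˡ r)) ⟩
    0# + (p * r + p * q′)                ≈⟨ +-identityˡ _ ⟩
    p * r + p * q′                       ≈⟨ +-congˡ move ⟩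
    p * r + p′ * q                       ∎
    where
    p = X i j
    p′ = X j i
    q = X u j
    q′ = X j u
    r = X u i
    -- Reversing both edges changes the sign twice.
    move : p * q′ ≈ p′ * q
    move = begin
      p * q′                       ≈⟨ +-identityʳ _ ⟨
      p * q′ + 0#                  ≈⟨ +-congˡ (trans (*-congʳ (X-anti i j)) (zeroˡ q)) ⟨
      p * q′ + (p + p′) * q        ≈⟨ solve 4 (λ p p′ q q′ → p :* q′ :+ (p :+ p′) :* q := p :* (q :+ q′) :+ p′ :* q) refl p p′ q q′ ⟩
      p * (q + q′) + p′ * q        ≈⟨ +-congʳ (trans (*-congˡ (X-anti u j)) (zeroʳ p)) ⟩
      0# + p′ * q                  ≈⟨ +-identityˡ _ ⟩
      p′ * q                       ∎

-- Transpositions, supports of terms and the action on terms.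

transpose-fst : ∀ {m} (a b : Fin m) → transpose a b ⟨$⟩ʳ a ≡ b
transpose-fst a b with a ≟ a
... | yes _  = ≡.refl
... | no a≢a = contradiction ≡.refl a≢a

transpose-snd : ∀ {m} (a b : Fin m) → transpose a b ⟨$⟩ʳ b ≡ a
transpose-snd a b with b ≟ a
... | yes b≡a = b≡a
... | no _ with b ≟ b
...   | yes _  = ≡.refl
...   | no b≢b = contradiction ≡.refl b≢b

transpose-other : ∀ {m} {a b c : Fin m} → c ≢ a → c ≢ b → transpose a b ⟨$⟩ʳ c ≡ c
transpose-other {a = a} {b} {c} c≢a c≢b with c ≟ a
... | yes c≡a = contradiction c≡a c≢a
... | no _ with c ≟ b
...   | yes c≡b = contradiction c≡b c≢b
...   | no _    = ≡.refl

-- A condition on the term as written, not on its class in the ring, so that it can be followed by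
-- induction on terms.
Over : ∀ {n} → (Fin (suc n) → Set) → Term (Pair n) → Set
Over S (var p) = S (Pair.fst p) × S (Pair.snd p)
Over S (con q) = ⊤
Over S (s ⊕ t) = Over S s × Over S t
Over S (s ⊗ t) = Over S s × Over S t
Over S (⊝ t)   = Over S t

Over-mono : ∀ {n} {S T : Fin (suc n) → Set} → (∀ {i} → S i → T i) → ∀ t → Over S t → Over T t
Over-mono f (var p) (i , j) = f i , f j
Over-mono f (con q) _       = tt
Over-mono f (s ⊕ t) (p , q) = Over-mono f s p , Over-mono f t q
Over-mono f (s ⊗ t) (p , q) = Over-mono f s p , Over-mono f t q
Over-mono f (⊝ t)   p       = Over-mono f t p

Over-all : ∀ {n} {S : Fin (suc n) → Set} → (∀ i → S i) → ∀ t → Over S t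
Over-all all (var p) = all _ , all _
Over-all all (con q) = tt
Over-all all (s ⊕ t) = Over-all all s , Over-all all t
Over-all all (s ⊗ t) = Over-all all s , Over-all all t
Over-all all (⊝ t)   = Over-all all t

var-cong : ∀ {n} {i i′ j j′ : Fin (suc n)} .{d : i ≢ j} .{d′ : i′ ≢ j′} →
  i ≡ i′ → j ≡ j′ → x i j d ≡ x i′ j′ d′
var-cong ≡.refl ≡.refl = ≡.refl

act-Over : ∀ {n} (σ : Permutation′ (suc n)) {S} → (∀ {i} → S i → σ ⟨$⟩ʳ i ≡ i) →
  ∀ t → Over S t → act σ t ≡ t
act-Over σ f (var p) (i , j) = var-cong (f i) (f j)
act-Over σ f (con q) _       = ≡.refl
act-Over σ f (s ⊕ t) (p , q) = ≡.cong₂ _⊕_ (act-Over σ f s p) (act-Over σ f t q)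
act-Over σ f (s ⊗ t) (p , q) = ≡.cong₂ _⊗_ (act-Over σ f s p) (act-Over σ f t q)
act-Over σ f (⊝ t)   p       = ≡.cong ⊝_ (act-Over σ f t p)

act-∘ : ∀ {n} (σ τ : Permutation′ (suc n)) t → act σ (act τ t) ≡ act (τ ∘ₚ σ) t
act-∘ σ τ (var p) = ≡.refl
act-∘ σ τ (con q) = ≡.refl
act-∘ σ τ (s ⊕ t) = ≡.cong₂ _⊕_ (act-∘ σ τ s) (act-∘ σ τ t)
act-∘ σ τ (s ⊗ t) = ≡.cong₂ _⊗_ (act-∘ σ τ s) (act-∘ σ τ t)
act-∘ σ τ (⊝ t)   = ≡.cong ⊝_ (act-∘ σ τ t)

act-ext : ∀ {n} (π ρ : Permutation′ (suc n)) → π Perm.≈ ρ → ∀ t → act π t ≡ act ρ t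
act-ext π ρ e (var p) = var-cong (e (Pair.fst p)) (e (Pair.snd p))
act-ext π ρ e (con q) = ≡.refl
act-ext π ρ e (s ⊕ t) = ≡.cong₂ _⊕_ (act-ext π ρ e s) (act-ext π ρ e t)
act-ext π ρ e (s ⊗ t) = ≡.cong₂ _⊗_ (act-ext π ρ e s) (act-ext π ρ e t)
act-ext π ρ e (⊝ t)   = ≡.cong ⊝_ (act-ext π ρ e t)

module Action (n : ℕ) where
  open ℚ-Algebra (VG-algebra n) hiding (zero)
  open Presentation (VGGen n) using (gen)
  open Relations n
  open Sum semiring using (sum)

  module _ (σ : Permutation′ (suc n)) where
    open Evaluation (VG-algebra n) (λ p → var (actPair σ p))

    act-⟦⟧ : ∀ t → act σ t ≡ ⟦ t ⟧
    act-⟦⟧ (var p) = ≡.refl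
    act-⟦⟧ (con q) = ≡.refl
    act-⟦⟧ (s ⊕ t) = ≡.cong₂ _⊕_ (act-⟦⟧ s) (act-⟦⟧ t)
    act-⟦⟧ (s ⊗ t) = ≡.cong₂ _⊗_ (act-⟦⟧ s) (act-⟦⟧ t)
    act-⟦⟧ (⊝ t)   = ≡.cong ⊝_ (act-⟦⟧ t)

    vanish : ∀ {g} → VGGen n g → ⟦ g ⟧ ≈ 0#
    vanish (sq i j d)        = gen (sq _ _ _)
    vanish (anti i j d d′)   = gen (anti _ _ _ _)
    vanish (tri i j k d e f) = gen (tri _ _ _ _ _ _)

    act-cong : ∀ {s t} → s ≈ t → act σ s ≈ act σ t
    act-cong {s} {t} e = trans (reflexive (act-⟦⟧ s))
      (trans (⟦⟧-cong vanish e) (reflexive (≡.sym (act-⟦⟧ t))))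

    act-X : ∀ i j → act σ (X i j) ≡ X (σ ⟨$⟩ʳ i) (σ ⟨$⟩ʳ j)
    act-X i j with i ≟ j
    ... | yes ≡.refl = ≡.sym (X-diag (σ ⟨$⟩ʳ i))
    ... | no d       = ≡.sym (X-x _ _ (d ∘ perm-inj σ))

    act-sum : ∀ {m} (f : Fin m → Carrier) → act σ (sum f) ≡ sum (act σ ∘ f)
    act-sum {zero}  f = ≡.refl
    act-sum {suc m} f = ≡.cong (act σ (f zero) ⊕_) (act-sum (f ∘ suc))

  last : Fin (suc n)
  last = fromℕ n

  -- The summand at `last` is zero; keeping it lets any permutation of the n+1 points that fixes
  -- `last` reindex the sum.
  Z : Carrier
  Z = sum (X last)

  Z-invariant : Invariant n Z
  Z-invariant σ fix = begin
    act σ Z                              ≡⟨ act-sum σ (X last) ⟩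
    sum (λ i → act σ (X last i))         ≡⟨ sum-cong-≗ (λ i → ≡.trans (act-X σ last i) (≡.cong (λ l → X l (σ ⟨$⟩ʳ i)) fix)) ⟩
    sum (λ i → X last (σ ⟨$⟩ʳ i))        ≈⟨ sum-permute (X last) σ ⟨
    Z                                    ∎
    where
    open SetoidReasoning setoid
    open Sum semiring using (sum-cong-≗; sum-permute)

-- Symmetrisation over the stabiliser of the last point.

module Symmetrisation (n : ℕ) where
  open ℚ-Algebra (VG-algebra n) hiding (zero)
  open Mult semiring using () renaming (_×_ to _·_)
  open Action n
  open PermutationSum commutativeRing

  extend : Permutation′ n → Permutation′ (suc n)
  extend = insert last last

  -- The Reynolds operator without the factor 1/n!, which `unscale` supplies at the end.
  Sym : Carrier → Carrier
  Sym t = ∑ₚ n (λ π → act (extend π) t)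

  Sym-cong : ∀ {s t} → s ≈ t → Sym s ≈ Sym t
  Sym-cong e = ∑ₚ-cong n λ π → act-cong (extend π) e

  Sym-+ : ∀ s t → Sym (s + t) ≈ Sym s + Sym t
  Sym-+ s t = ∑ₚ-+ n _ _

  Sym-* : ∀ {c} → Invariant n c → ∀ t → Sym (c * t) ≈ c * Sym t
  Sym-* {c} inv t = trans
    (∑ₚ-cong n λ π → *-congʳ (inv (extend π) (insert-self last last π)))
    (∑ₚ-* n c _)

  Sym-invariant : ∀ {a} → Invariant n a → Sym a ≈ (n !) · a
  Sym-invariant {a} inv = trans
    (∑ₚ-cong n λ π → inv (extend π) (insert-self last last π))
    (∑ₚ-const n a)

  -- By `∘-insert`, `τ` followed by `extend π` is again an extension, so acting by `τ` first only
  -- reindexes the sum.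
  Sym-act : ∀ τ → Fixes-last τ → ∀ t → Sym (act τ t) ≈ Sym t
  Sym-act τ fix t = trans
    (∑ₚ-cong n λ π → reflexive (≡.trans (act-∘ (extend π) τ t)
      (act-ext (τ ∘ₚ extend π) (extend (remove last τ ∘ₚ π)) (∘-insert τ fix last π) t)))
    (∑ₚ-∘ n (λ π → act (extend π) t)
      (λ π ρ e → reflexive (act-ext (extend π) (extend ρ) (insert-cong last last {π} {ρ} e) t))
      (remove last τ))

  infix 4 _∼_
  -- A record, so that `s` and `t` can be inferred; an equation between unfolded sums would not
  -- determine them.
  record _∼_ (s t : Carrier) : Set where
    constructor mk∼
    field Sym-≈ : Sym s ≈ Sym t
  open _∼_ public

  ≈⇒∼ : ∀ {s t} → s ≈ t → s ∼ t
  ≈⇒∼ e = mk∼ (Sym-cong e)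

  ∼-sym : ∀ {s t} → s ∼ t → t ∼ s
  ∼-sym (mk∼ p) = mk∼ (sym p)

  ∼-trans : ∀ {s t u} → s ∼ t → t ∼ u → s ∼ u
  ∼-trans (mk∼ p) (mk∼ q) = mk∼ (trans p q)

  ∼-+ : ∀ {s s′ t t′} → s ∼ s′ → t ∼ t′ → s + t ∼ s′ + t′
  ∼-+ (mk∼ p) (mk∼ q) = mk∼ (trans (Sym-+ _ _) (trans (+-cong p q) (sym (Sym-+ _ _))))

  Sym-0 : Sym 0# ≈ 0#
  Sym-0 = trans (Sym-cong (sym (zeroˡ 0#))) (trans (Sym-* (λ _ _ → refl) 0#) (zeroˡ _))

  Sym-· : ∀ k t → Sym (k · t) ≈ k · Sym t
  Sym-· zero    t = Sym-0
  Sym-· (suc k) t = trans (Sym-+ t _) (+-congˡ (Sym-· k t))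

  ∼-· : ∀ k {s t} → s ∼ t → k · s ∼ k · t
  ∼-· zero    e = mk∼ refl
  ∼-· (suc k) e = ∼-+ e (∼-· k e)

  infix 4 _#_
  _#_ : Fin (suc n) → List (Fin (suc n)) → Set
  i # is = All (i ≢_) is

  -- The transposition fixes `last`, hence leaves `Sym` unchanged, and it fixes `C`, in which
  -- neither point occurs.
  swap : ∀ {a b} C t → last # a ∷ b ∷ [] → Over (_# a ∷ b ∷ []) C →
    C * t ∼ C * act (transpose a b) t
  swap {a} {b} C t (l≢a ∷ l≢b ∷ []) free = mk∼ (trans
    (sym (Sym-act (transpose a b) (transpose-other l≢a l≢b) (C * t)))
    (Sym-cong (*-congʳ (reflexive
      (act-Over (transpose a b) (λ { (i≢a ∷ i≢b ∷ []) → transpose-other i≢a i≢b }) C free)))))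

-- Path monomials.

module Paths (n : ℕ) where
  open ℚ-Algebra (VG-algebra n) hiding (zero)
  open Relations n
  open Action n
  open Symmetrisation n
  open RingProperties ring using (-‿distribˡ-*; -‿distribʳ-*)
  open Mult semiring using (×-homo-+) renaming (_×_ to _·_)
  open SemiringSolver commutativeSemiring using (solve; _:=_; _:+_; _:*_)
  open Sum semiring using (sum; sum-remove; *-distribʳ-sum)
  open SetoidReasoning setoid

  P : Fin (suc n) → List (Fin (suc n)) → Carrier
  P v []       = 1#
  P v (w ∷ ws) = X v w * P w ws

  -- There are `suc (length ws)` positions for `a`, the last being the end of the path; this is the
  -- factor in `insertions∼`.
  insertions : Fin (suc n) → List (Fin (suc n)) → Fin (suc n) → Carrier
  insertions v []       a = X v a * 1#
  insertions v (w ∷ ws) a = X v a * (X a w * P w ws) + X v w * insertions w ws a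

  -- Applied at `v`, `star` either places `a` between `v` and `w` or moves the extra edge on to
  -- start at `w`, where induction takes over.
  X*P≈insertions : ∀ v ws a → X v a * P v ws ≈ insertions v ws a
  X*P≈insertions v []       a = refl
  X*P≈insertions v (w ∷ ws) a = begin
    X v a * (X v w * P w ws)
      ≈⟨ *-assoc _ _ _ ⟨
    X v a * X v w * P w ws
      ≈⟨ *-congʳ (star v a w) ⟩
    (X a w * X v a + X w a * X v w) * P w ws
      ≈⟨ solve 5 (λ aw va wa vw p → (aw :* va :+ wa :* vw) :* p := va :* (aw :* p) :+ vw :* (wa :* p))
           refl (X a w) (X v a) (X w a) (X v w) (P w ws) ⟩
    X v a * (X a w * P w ws) + X v w * (X w a * P w ws)
      ≈⟨ +-congˡ (*-congˡ (X*P≈insertions w ws a)) ⟩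
    X v a * (X a w * P w ws) + X v w * insertions w ws a ∎

  -- `star` pushes the extra edge along the path until it doubles the edge entering `a`, whose
  -- square is zero.
  P-cycle : ∀ v ws {a} → a ∈ ws → X v a * P v ws ≈ 0#
  P-cycle v (w ∷ ws) (here ≡.refl) =
    trans (sym (*-assoc _ _ _)) (trans (*-congʳ (X-sq v w)) (zeroˡ _))
  P-cycle v (w ∷ ws) {a} (there a∈ws) = begin
    X v a * (X v w * P w ws)
      ≈⟨ *-assoc _ _ _ ⟨
    X v a * X v w * P w ws
      ≈⟨ *-congʳ (star v a w) ⟩
    (X a w * X v a + X w a * X v w) * P w ws
      ≈⟨ *-congʳ (+-congʳ (trans (*-congʳ (X-flip a w)) (trans (sym (-‿distribˡ-* _ _)) (-‿distribʳ-* _ _)))) ⟩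
    (X w a * - X v a + X w a * X v w) * P w ws
      ≈⟨ solve 4 (λ wa va vw p → (wa :* va :+ wa :* vw) :* p := (va :+ vw) :* (wa :* p))
           refl (X w a) (- X v a) (X v w) (P w ws) ⟩
    (- X v a + X v w) * (X w a * P w ws)
      ≈⟨ *-congˡ (P-cycle w ws a∈ws) ⟩
    (- X v a + X v w) * 0#
      ≈⟨ zeroʳ _ ⟩
    0# ∎

  act-P : ∀ σ v ws → act σ (P v ws) ≡ P (σ ⟨$⟩ʳ v) (map (σ ⟨$⟩ʳ_) ws)
  act-P σ v []       = ≡.refl
  act-P σ v (w ∷ ws) = ≡.cong₂ _⊗_ (act-X σ v w) (act-P σ w ws)

  X-Over : ∀ (S : Fin (suc n) → Set) i j → S i → S j → Over S (X i j)
  X-Over S i j p q with i ≟ j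
  ... | yes _ = tt
  ... | no _  = p , q

  map-transpose : ∀ {a b ws} → a # ws → b # ws → map (transpose a b ⟨$⟩ʳ_) ws ≡ ws
  map-transpose a# b# = map-id-local (All.zipWith
    (λ (a≢w , b≢w) → transpose-other (a≢w ∘ ≡.sym) (b≢w ∘ ≡.sym)) (a# , b#))

  swap-next : ∀ {v a w ws} C → v ≢ a → v ≢ w → a # ws → w # ws →
    last # a ∷ w ∷ [] → Over (_# a ∷ w ∷ []) C →
    C * P v (w ∷ a ∷ ws) ∼ C * P v (a ∷ w ∷ ws)
  swap-next {v} {a} {w} {ws} C v≢a v≢w a# w# l# free =
    ∼-trans (swap C (P v (w ∷ a ∷ ws)) l# free) (≈⇒∼ (*-congˡ (reflexive path)))
    where
    path : act (transpose a w) (P v (w ∷ a ∷ ws)) ≡ P v (a ∷ w ∷ ws)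
    path rewrite act-P (transpose a w) v (w ∷ a ∷ ws)
      | transpose-other v≢a v≢w | transpose-snd a w | transpose-fst a w
      | map-transpose a# w# = ≡.refl

  swap-start : ∀ {v a ws} C → v # ws → a # ws →
    last # a ∷ v ∷ [] → Over (_# a ∷ v ∷ []) C →
    C * P v (a ∷ ws) ∼ C * P a (v ∷ ws)
  swap-start {v} {a} {ws} C v# a# l# free =
    ∼-trans (swap C (P v (a ∷ ws)) l# free) (≈⇒∼ (*-congˡ (reflexive path)))
    where
    path : act (transpose a v) (P v (a ∷ ws)) ≡ P a (v ∷ ws)
    path rewrite act-P (transpose a v) v (a ∷ ws)
      | transpose-snd a v | transpose-fst a v | map-transpose a# v# = ≡.refl

  swap-second : ∀ {v a b ws} → v ≢ a → v ≢ b → a # ws → b # ws →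
    last # a ∷ b ∷ [] → P v (a ∷ ws) ∼ P v (b ∷ ws)
  swap-second {v} {a} {b} {ws} v≢a v≢b a# b# l# =
    ∼-trans (≈⇒∼ (sym (*-identityˡ _))) (∼-trans (swap 1# (P v (a ∷ ws)) l# tt)
      (≈⇒∼ (trans (*-identityˡ _) (reflexive path))))
    where
    path : act (transpose a b) (P v (a ∷ ws)) ≡ P v (b ∷ ws)
    path rewrite act-P (transpose a b) v (a ∷ ws)
      | transpose-other v≢a v≢b | transpose-fst a b | map-transpose a# b# = ≡.refl

  -- Neighbouring insertions differ by exchanging `a` with the vertex it passes. Induction brings
  -- `a` directly behind `w`, and `swap-next` moves it in front.
  insertions∼ : ∀ v ws a C → Unique (v ∷ a ∷ ws) → last # a ∷ ws → Over (_# a ∷ ws) C →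
    C * insertions v ws a ∼ suc (length ws) · (C * P v (a ∷ ws))
  insertions∼ v []       a C _ _ _ = ≈⇒∼ (sym (+-identityʳ _))
  insertions∼ v (w ∷ ws) a C
    ((v≢a ∷ v≢w ∷ v#) ∷ (a≢w ∷ a#) ∷ w# ∷ u) (l≢a ∷ l≢w ∷ l#) free =
    ∼-trans (≈⇒∼ (trans (distribˡ _ _ _) (+-congˡ (sym (*-assoc _ _ _)))))
      (∼-+ (mk∼ refl) (∼-trans
        -- The edge from `v` to `w` joins the coefficient, as it meets neither `a` nor the rest of
        -- the path.
        (insertions∼ w ws a (C * X v w) ((a≢w ∘ ≡.sym ∷ w#) ∷ a# ∷ u) (l≢a ∷ l#)
          (Over-mono (λ { (p ∷ _ ∷ q) → p ∷ q }) C free ,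
           X-Over (_# a ∷ ws) v w (v≢a ∷ v#) (a≢w ∘ ≡.sym ∷ w#)))
        (∼-· (suc (length ws)) (∼-trans (≈⇒∼ (*-assoc _ _ _))
          (swap-next C v≢a v≢w a# w# (l≢a ∷ l≢w ∷ [])
            (Over-mono (λ { (p ∷ q ∷ _) → p ∷ q ∷ [] }) C free))))))

  -- Moving a to the start turns the insertion formula into (k+2) · (C * P a (v ∷ ws)) ∼ 0.
  free-path∼0 : ∀ C a v ws → Unique (a ∷ v ∷ ws) → last # a ∷ v ∷ ws → Over (_# a ∷ v ∷ ws) C →
    C * P a (v ∷ ws) ∼ 0#
  free-path∼0 C a v ws ((a≢v ∷ a#) ∷ v# ∷ u) (l≢a ∷ l≢v ∷ l#) free =
    mk∼ (trans (Division.torsion-free (VG-algebra n) (suc (length ws))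
      (trans (sym (Sym-· (suc (suc (length ws))) Y)) (trans (Sym-≈ multiple) Sym-0))) (sym Sym-0))
    where
    Y = C * P a (v ∷ ws)

    cancels : Y + C * insertions v ws a ≈ 0#
    cancels = begin
      C * (X a v * P v ws) + C * insertions v ws a
        ≈⟨ +-congˡ (*-congˡ (X*P≈insertions v ws a)) ⟨
      C * (X a v * P v ws) + C * (X v a * P v ws)
        ≈⟨ solve 4 (λ c p q r → c :* (p :* r) :+ c :* (q :* r) := (p :+ q) :* (c :* r))
             refl C (X a v) (X v a) (P v ws) ⟩
      (X a v + X v a) * (C * P v ws)
        ≈⟨ *-congʳ (X-anti a v) ⟩
      0# * (C * P v ws)
        ≈⟨ zeroˡ _ ⟩
      0# ∎

    -- One copy is `Y` itself; the other `suc (length ws)` are the insertions, carried to `Y` by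
    -- exchanging `a` and `v`.
    multiple : suc (suc (length ws)) · Y ∼ 0#
    multiple = ∼-trans (∼-+ (mk∼ refl) (∼-sym (∼-trans
      (insertions∼ v ws a C ((a≢v ∘ ≡.sym ∷ v#) ∷ a# ∷ u) (l≢a ∷ l#)
        (Over-mono (λ { (p ∷ _ ∷ q) → p ∷ q }) C free))
      (∼-· (suc (length ws)) (swap-start C v# a# (l≢a ∷ l≢v ∷ [])
        (Over-mono (λ { (p ∷ q ∷ _) → p ∷ q ∷ [] }) C free))))))
      (≈⇒∼ cancels)

  -- Coefficients in ℕ ensure that the other summands cannot cancel the positive contribution of `b`
  -- in `Z*P∼`.
  sum-multiples : ∀ {m} (f : Fin m → Carrier) {Y} → (∀ i → ∃ λ c → f i ∼ c · Y) → ∃ λ c → sum f ∼ c · Y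
  sum-multiples {zero}  f mult = 0 , mk∼ refl
  sum-multiples {suc m} f {Y} mult with mult zero | sum-multiples (f ∘ suc) (mult ∘ suc)
  ... | c , p | d , q = c ℕ.+ d , ∼-trans (∼-+ p q) (≈⇒∼ (sym (×-homo-+ Y c d)))

  -- Z * P last ws sums the insertions of all a, and those of unused a agree up to a transposition.
  Z*P∼ : ∀ b ws → Unique (last ∷ b ∷ ws) → ∃ λ c → Z * P last ws ∼ suc c · P last (b ∷ ws)
  Z*P∼ b ws ((l≢b ∷ l#) ∷ b# ∷ u) = length ws ℕ.+ proj₁ rest ,
    ∼-trans (≈⇒∼ (trans (*-distribʳ-sum (P last ws) (X last)) (sum-remove {i = b} T)))
      (∼-trans (∼-+ (new b l≢b b#) (proj₂ rest))
        (≈⇒∼ (sym (×-homo-+ (P last (b ∷ ws)) (suc (length ws)) (proj₁ rest)))))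
    where
    T : Fin (suc n) → Carrier
    T a = X last a * P last ws

    new : ∀ a → last ≢ a → a # ws → T a ∼ suc (length ws) · P last (b ∷ ws)
    new a l≢a a# = ∼-trans (≈⇒∼ (trans (X*P≈insertions last ws a) (sym (*-identityˡ _))))
      (∼-trans (insertions∼ last ws a 1# ((l≢a ∷ l#) ∷ a# ∷ u) (l≢a ∷ l#) tt)
        (∼-· (suc (length ws)) (∼-trans (≈⇒∼ (*-identityˡ _))
          (swap-second l≢a l≢b a# b# (l≢a ∷ l≢b ∷ [])))))

    -- The summand vanishes when `a` is `last` or already lies on the path; otherwise `new` applies.
    multiple : ∀ a → ∃ λ c → T a ∼ c · P last (b ∷ ws)
    multiple a with member? _≟_ a (last ∷ ws)
    ... | yes (here ≡.refl)  = 0 , ≈⇒∼ (trans (*-congʳ (reflexive (X-diag last))) (zeroˡ _))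
    ... | yes (there a∈ws)   = 0 , ≈⇒∼ (P-cycle last ws a∈ws)
    ... | no a∉ with ¬Any⇒All¬ (last ∷ ws) a∉
    ...   | a≢l ∷ a# = suc (length ws) , new a (a≢l ∘ ≡.sym) a#

    rest : ∃ λ c → sum (removeAt T b) ∼ c · P last (b ∷ ws)
    rest = sum-multiples (removeAt T b) (multiple ∘ punchIn b)

-- Symmetrised elements as polynomials in Z.

module Spanning (n : ℕ) where
  open ℚ-Algebra (VG-algebra n) hiding (zero)
  open Relations n
  open Action n
  open Symmetrisation n
  open Paths n
  open RingProperties ring using (-1*x≈-x)
  open Mult semiring using () renaming (_×_ to _·_)
  open SemiringSolver commutativeSemiring using (solve; _:=_; _:+_; _:*_)
  open SetoidReasoning setoid
  open Evaluation (VG-algebra n) (λ (_ : ⊤) → Z) public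

  ⟦⟧-invariant : ∀ p → Invariant n ⟦ p ⟧
  ⟦⟧-invariant (var _) σ f = Z-invariant σ f
  ⟦⟧-invariant (con q) σ f = refl
  ⟦⟧-invariant (p ⊕ q) σ f = +-cong (⟦⟧-invariant p σ f) (⟦⟧-invariant q σ f)
  ⟦⟧-invariant (p ⊗ q) σ f = *-cong (⟦⟧-invariant p σ f) (⟦⟧-invariant q σ f)
  ⟦⟧-invariant (⊝ p)   σ f = -‿cong (⟦⟧-invariant p σ f)

  Good : Carrier → Set
  Good t = ∃ λ p → Sym t ≈ ⟦ p ⟧

  Good-∼ : ∀ {s t} → s ∼ t → Good t → Good s
  Good-∼ (mk∼ e) (p , g) = p , trans e g

  Good-≈ : ∀ {s t} → s ≈ t → Good t → Good s
  Good-≈ e = Good-∼ (≈⇒∼ e)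

  Good-+ : ∀ {s t} → Good s → Good t → Good (s + t)
  Good-+ (p , g) (q , h) = p ⊕ q , trans (Sym-+ _ _) (+-cong g h)

  Good-⟦⟧* : ∀ q {t} → Good t → Good (⟦ q ⟧ * t)
  Good-⟦⟧* q (p , g) = q ⊗ p , trans (Sym-* (⟦⟧-invariant q) _) (*-congˡ g)

  Good-1 : Good 1#
  Good-1 = con (ℕ→ℚ (n !)) ,
    trans (Sym-invariant {1#} (λ _ _ → refl))
      (trans (sym (Division.κ-ℕ (VG-algebra n) (n !) 1#)) (*-identityʳ _))

  Good-0 : Good 0#
  Good-0 = con 0ℚ , Sym-0

  Good-divide : ∀ k {t} → Good (suc k · t) → Good t
  Good-divide k {t} (p , g) = con (recip k) ⊗ p ,
    Division.divide (VG-algebra n) k (trans (sym (Sym-· (suc k) t)) g)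

  -- By `Z*P∼`, the path is up to a positive factor `Z` times the path without `b`, and
  -- multiplication by the invariant `Z` commutes with `Sym`.
  Good-path : ∀ ws → Unique (last ∷ ws) → Good (P last ws)
  Good-path []       _ = Good-1
  Good-path (b ∷ ws) u@((_ ∷ l#) ∷ _ ∷ u′) = extend-path (Z*P∼ b ws u)
    where
    extend-path : (∃ λ c → Z * P last ws ∼ suc c · P last (b ∷ ws)) → Good (P last (b ∷ ws))
    extend-path (c , e) = Good-divide c (Good-∼ (∼-sym e) (Good-⟦⟧* z (Good-path ws (l# ∷ u′))))

  Over-[]⇒con : ∀ t → Over (_∈ []) t → ∃ λ q → t ≈ con q
  Over-[]⇒con (con q) _ = q , refl
  Over-[]⇒con (s ⊕ t) (o , o′) with Over-[]⇒con s o | Over-[]⇒con t o′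
  ... | p , e | q , f = p ℚ.+ q , trans (+-cong e f) (sym (κ-+ p q))
  Over-[]⇒con (s ⊗ t) (o , o′) with Over-[]⇒con s o | Over-[]⇒con t o′
  ... | p , e | q , f = p ℚ.* q , trans (*-cong e f) (sym (κ-* p q))
  Over-[]⇒con (⊝ t) o with Over-[]⇒con t o
  ... | q , e = ℚ.- q , trans (-‿cong e) (sym (+-inverseˡ-unique _ _
    (trans (sym (κ-+ (ℚ.- q) q)) (reflexive (≡.cong con (ℚₚ.+-inverseˡ q))))))
    where open RingProperties ring using (+-inverseˡ-unique)

  -- Sums a + Σ bᵢ x_ui with a and bᵢ supported on R.
  data Linear (u : Fin (suc n)) (R : List (Fin (suc n))) : Carrier → Set where
    base : ∀ {a} → Over (_∈ R) a → Linear u R a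
    edge : ∀ {b i} → i ∈ R → Over (_∈ R) b → Linear u R (b * X u i)
    plus : ∀ {s t} → Linear u R s → Linear u R t → Linear u R (s + t)
    resp : ∀ {s t} → s ≈ t → Linear u R t → Linear u R s

  module _ {u : Fin (suc n)} {R : List (Fin (suc n))} where

    -- Only the product of two edges at `u` lacks the linear shape; `star` restores it with new
    -- coefficients that stay within `R`.
    Linear-* : ∀ {s t} → Linear u R s → Linear u R t → Linear u R (s * t)
    Linear-* (resp e p) q = resp (*-congʳ e) (Linear-* p q)
    Linear-* (plus p p′) q = resp (distribʳ _ _ _) (plus (Linear-* p q) (Linear-* p′ q))
    Linear-* p@(base _) (resp e q) = resp (*-congˡ e) (Linear-* p q)
    Linear-* p@(edge _ _) (resp e q) = resp (*-congˡ e) (Linear-* p q)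
    Linear-* p@(base _) (plus q q′) = resp (distribˡ _ _ _) (plus (Linear-* p q) (Linear-* p q′))
    Linear-* p@(edge _ _) (plus q q′) = resp (distribˡ _ _ _) (plus (Linear-* p q) (Linear-* p q′))
    Linear-* (base o) (base o′) = base (o , o′)
    Linear-* (base o) (edge i∈R o′) = resp (sym (*-assoc _ _ _)) (edge i∈R (o , o′))
    Linear-* (edge i∈R o) (base o′) =
      resp (trans (*-comm _ _) (sym (*-assoc _ _ _))) (edge i∈R (o′ , o))
    Linear-* (edge {b} {i} i∈R o) (edge {c} {j} j∈R o′) =
      resp expand (plus (edge i∈R ((o , o′) , X-Over (_∈ R) i j i∈R j∈R)) (edge j∈R ((o , o′) , X-Over (_∈ R) j i j∈R i∈R)))
      where
      expand : (b * X u i) * (c * X u j) ≈ ((b * c) * X i j) * X u i + ((b * c) * X j i) * X u j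
      expand = begin
        (b * X u i) * (c * X u j)
          ≈⟨ solve 4 (λ b p c q → (b :* p) :* (c :* q) := (b :* c) :* (p :* q)) refl b (X u i) c (X u j) ⟩
        (b * c) * (X u i * X u j)
          ≈⟨ *-congˡ (star u i j) ⟩
        (b * c) * (X i j * X u i + X j i * X u j)
          ≈⟨ solve 5 (λ d p q r s → d :* (p :* q :+ r :* s) := (d :* p) :* q :+ (d :* r) :* s)
               refl (b * c) (X i j) (X u i) (X j i) (X u j) ⟩
        ((b * c) * X i j) * X u i + ((b * c) * X j i) * X u j ∎

    Linear-X : ∀ {i j} → i ∈ u ∷ R → j ∈ u ∷ R → Linear u R (X i j)
    Linear-X (here ≡.refl) (here ≡.refl) = resp (reflexive (X-diag u)) (base {a = con 0ℚ} tt)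
    Linear-X (here ≡.refl) (there j∈R)   = resp (sym (*-identityˡ _)) (edge {b = con 1ℚ} j∈R tt)
    Linear-X (there i∈R)   (here ≡.refl) = resp (trans (X-flip _ u) (sym (-1*x≈-x _))) (edge {b = ⊝ con 1ℚ} i∈R tt)
    Linear-X (there i∈R)   (there j∈R)   = base (X-Over (_∈ R) _ _ i∈R j∈R)

    linear : ∀ t → Over (_∈ u ∷ R) t → Linear u R t
    linear (var record { fst = i ; snd = j ; distinct = d }) (i∈ , j∈) =
      resp (reflexive (≡.sym (X-x i j d))) (Linear-X i∈ j∈)
    linear (con q) _        = base tt
    linear (s ⊕ t) (o , o′) = plus (linear s o) (linear t o′)
    linear (s ⊗ t) (o , o′) = Linear-* (linear s o) (linear t o′)
    linear (⊝ t)   o        = resp (sym (-1*x≈-x t)) (Linear-* (base {a = ⊝ con 1ℚ} tt) (linear t o))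

  without : Fin (suc n) → List (Fin (suc n)) → List (Fin (suc n))
  without i = filter (λ j → ¬? (j ≟ i))

  without-⊆ : ∀ {i j R} → j ∈ without i R → j ∈ R
  without-⊆ {i} j∈ = proj₁ (∈-filter⁻ (λ j → ¬? (j ≟ i)) j∈)

  without-∌ : ∀ {i R} → i ∉ without i R
  without-∌ {i} {R} i∈ = proj₂ (∈-filter⁻ (λ j → ¬? (j ≟ i)) {xs = R} i∈) ≡.refl

  without-length : ∀ {i R} → i ∈ R → length (without i R) ℕ.< length R
  without-length {i} {R} i∈R = filter-notAll (λ j → ¬? (j ≟ i)) R
    (Any.map (λ i≡j j≢i → j≢i (≡.sym i≡j)) i∈R)

  without-cover : ∀ {i j R} → j ∈ R → j ∈ i ∷ without i R
  without-cover {i} {j} j∈R with j ≟ i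
  ... | yes j≡i = here j≡i
  ... | no j≢i  = there (∈-filter⁺ (λ j → ¬? (j ≟ i)) j∈R j≢i)

  ∉⇒# : ∀ {i R ws} → i ∉ R → All (_∈ R) ws → i # ws
  ∉⇒# i∉R = All.map λ { w∈R ≡.refl → i∉R w∈R }

  -- C is a term in the points already used; R lists those still free.
  reduce : ∀ fuel R → length R ℕ.≤ fuel → ∀ u C t →
    u ∉ R → last ∉ R → Over (_∉ R) C → Over (_∈ u ∷ R) t →
    (∀ ws → Unique (u ∷ ws) → All (_∈ R) ws → Good (C * P u ws)) → Good (C * t)
  reduce fuel R len u C t u∉R l∉R free o paths = go (linear t o)
    where
    -- A factor that avoids `u` is reduced from a fresh base point `r`. Nontrivial paths from `r`
    -- avoid `last` and are killed by `free-path∼0`, so only the trivial path is left.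
    constant : ∀ fuel R → length R ℕ.≤ fuel → last ∉ R → Over (_∉ R) C → Good (C * 1#) →
      ∀ {a} → Over (_∈ R) a → Good (C * a)
    constant _ [] _ _ _ good-C {a} o with Over-[]⇒con a o
    ... | q , e = Good-≈ (trans (*-congˡ e) (trans (*-comm _ _) (*-congˡ (sym (*-identityʳ C)))))
                    (Good-⟦⟧* (con q) good-C)
    constant (suc fuel) R@(r ∷ _) len l∉R free good-C {a} o =
      reduce fuel (without r R) (≤-pred (≤-trans (without-length {R = R} (here ≡.refl)) len)) r C a
        (without-∌ {R = R}) (l∉R ∘ without-⊆ {R = R}) (Over-mono (_∘ without-⊆ {R = R}) C free)
        (Over-mono (without-cover {R = R}) a o)
        λ { []       _ _    → good-C
          ; (w ∷ ws) u′ ws⊆ →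
              let ws⊆R = here ≡.refl ∷ All.map (without-⊆ {R = R}) ws⊆ in
              Good-∼ (free-path∼0 C r w ws u′ (∉⇒# l∉R ws⊆R) (Over-mono (λ i∉R → ∉⇒# i∉R ws⊆R) C free)) Good-0 }

    go : ∀ {t} → Linear u R t → Good (C * t)
    go (base o)   = constant fuel R len l∉R free (paths [] ([] ∷ []) []) o
    go (plus p q) = Good-≈ (distribˡ _ _ _) (Good-+ (go p) (go q))
    go (resp e p) = Good-≈ (*-congˡ e) (go p)
    -- The edge from `u` to `i` moves into `C`, and `i` leaves `R` to become the base point. Paths
    -- from `i` are prolonged backwards by this edge to paths from `u`.
    go (edge {b} {i} i∈R o) = step fuel len
      where
      step : ∀ fuel → length R ℕ.≤ fuel → Good (C * (b * X u i))
      -- `R` contains `i`, so its length cannot be bounded by zero.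
      step zero len with ≤-trans (without-length i∈R) len
      ... | ()
      step (suc fuel) len = Good-≈ (trans (*-congˡ (*-comm b _)) (sym (*-assoc _ _ _)))
        (reduce fuel (without i R) (≤-pred (≤-trans (without-length i∈R) len)) i (C * X u i) b
          (without-∌ {R = R}) (l∉R ∘ without-⊆ {R = R})
          (Over-mono (_∘ without-⊆ {R = R}) C free , X-Over (_∉ without i R) u i (u∉R ∘ without-⊆ {R = R}) (without-∌ {R = R}))
          (Over-mono (without-cover {R = R}) b o)
          λ ws u′ ws⊆ → let ws⊆R = All.map (without-⊆ {R = R}) ws⊆ in
            Good-≈ (*-assoc _ _ _) (paths (i ∷ ws) (∉⇒# u∉R (i∈R ∷ ws⊆R) ∷ u′) (i∈R ∷ ws⊆R)))

-- The truncated polynomial ring.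

module Truncated (n : ℕ) where
  open ℚ-Algebra (presented (TruncGen n)) public hiding (zero)
  open Presentation (TruncGen n) using (gen)
  open SemiringSolver commutativeSemiring using (solve; _:=_; _:+_; _:*_)
  open RingProperties ring using (-1*x≈-x)
  open SetoidReasoning setoid

  -- Coefficients are exposed one at a time from the constant one upwards, the order in which
  -- `z^-injective` shows them to vanish.
  data Horner : Carrier → Set where
    nil  : ∀ {t} → t ≈ 0# → Horner t
    cons : ∀ {t} c {s} → t ≈ con c + z * s → Horner s → Horner t

  Horner-resp : ∀ {s t} → s ≈ t → Horner t → Horner s
  Horner-resp e (nil f)      = nil (trans e f)
  Horner-resp e (cons c f h) = cons c (trans e f) h

  Horner-+ : ∀ {s t} → Horner s → Horner t → Horner (s + t)
  Horner-+ (nil e) h = Horner-resp (trans (+-congʳ e) (+-identityˡ _)) h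
  Horner-+ h@(cons _ _ _) (nil e) = Horner-resp (trans (+-congˡ e) (+-identityʳ _)) h
  Horner-+ (cons c {s} e h) (cons d {t} f k) = cons (c ℚ.+ d) (begin
    _                                       ≈⟨ +-cong e f ⟩
    (con c + z * s) + (con d + z * t)
      ≈⟨ solve 5 (λ c d z s t → (c :+ z :* s) :+ (d :+ z :* t) := (c :+ d) :+ z :* (s :+ t))
           refl (con c) (con d) z s t ⟩
    (con c + con d) + z * (s + t)           ≈⟨ +-congʳ (κ-+ c d) ⟨
    con (c ℚ.+ d) + z * (s + t)             ∎) (Horner-+ h k)

  Horner-scale : ∀ c {t} → Horner t → Horner (con c * t)
  Horner-scale c (nil e) = nil (trans (*-congˡ e) (zeroʳ _))
  Horner-scale c (cons d {t} e h) = cons (c ℚ.* d) (begin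
    _                              ≈⟨ *-congˡ e ⟩
    con c * (con d + z * t)
      ≈⟨ solve 4 (λ c d z t → c :* (d :+ z :* t) := c :* d :+ z :* (c :* t)) refl (con c) (con d) z t ⟩
    con c * con d + z * (con c * t) ≈⟨ +-congʳ (κ-* c d) ⟨
    con (c ℚ.* d) + z * (con c * t) ∎) (Horner-scale c h)

  Horner-* : ∀ {s t} → Horner s → Horner t → Horner (s * t)
  Horner-* (nil e) k = nil (trans (*-congʳ e) (zeroˡ _))
  Horner-* {t = t} (cons c {s} e h) k = Horner-resp (begin
    _                          ≈⟨ *-congʳ e ⟩
    (con c + z * s) * t
      ≈⟨ solve 4 (λ c z s t → (c :+ z :* s) :* t := c :* t :+ z :* (s :* t)) refl (con c) z s t ⟩
    con c * t + z * (s * t)    ∎)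
    (Horner-+ (Horner-scale c k) (cons 0ℚ (sym (+-identityˡ _)) (Horner-* h k)))

  horner-con : ∀ c → Horner (con c)
  horner-con c = cons c (sym (trans (+-congˡ (zeroʳ z)) (+-identityʳ _))) (nil refl)

  horner : ∀ t → Horner t
  horner (var tt) = cons 0ℚ (sym (trans (+-identityˡ _) (*-identityʳ z))) (horner-con 1ℚ)
  horner (con q)  = horner-con q
  horner (s ⊕ t)  = Horner-+ (horner s) (horner t)
  horner (s ⊗ t)  = Horner-* (horner s) (horner t)
  horner (⊝ t)    = Horner-resp (trans (sym (-1*x≈-x t)) (*-congʳ (sym con-neg)))
                      (Horner-scale (ℚ.- 1ℚ) (horner t))
    where
    open RingProperties ring using (+-inverseˡ-unique)
    con-neg : con (ℚ.- 1ℚ) ≈ - 1#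
    con-neg = +-inverseˡ-unique _ _ (sym (κ-+ (ℚ.- 1ℚ) 1ℚ))

  z^-+ : ∀ k m → (z ^ᵗ k) * (z ^ᵗ m) ≈ z ^ᵗ (k ℕ.+ m)
  z^-+ zero    m = *-identityˡ _
  z^-+ (suc k) m = trans (*-assoc _ _ _) (*-congˡ (z^-+ k m))

  z^-vanish : ∀ m → n ℕ.< m → z ^ᵗ m ≈ 0#
  z^-vanish m n<m = begin
    z ^ᵗ m                                   ≡⟨ ≡.cong (z ^ᵗ_) (m∸n+n≡m n<m) ⟨
    z ^ᵗ (m ℕ.∸ suc n ℕ.+ suc n)             ≈⟨ z^-+ (m ℕ.∸ suc n) (suc n) ⟨
    (z ^ᵗ (m ℕ.∸ suc n)) * (z ^ᵗ suc n)      ≈⟨ *-congˡ (gen top) ⟩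
    (z ^ᵗ (m ℕ.∸ suc n)) * 0#                ≈⟨ zeroʳ _ ⟩
    0#                                       ∎

  -- z^(n∸m) kills everything in z^m (c + z s) except the term c zⁿ.
  leading-term : ∀ m → m ≤ n → ∀ c s →
    (z ^ᵗ (n ℕ.∸ m)) * ((z ^ᵗ m) * (con c + z * s)) ≈ con c * (z ^ᵗ n)
  leading-term m m≤n c s = begin
    (z ^ᵗ (n ℕ.∸ m)) * ((z ^ᵗ m) * (con c + z * s))
      ≈⟨ *-assoc _ _ _ ⟨
    (z ^ᵗ (n ℕ.∸ m)) * (z ^ᵗ m) * (con c + z * s)
      ≈⟨ *-congʳ (trans (z^-+ (n ℕ.∸ m) m) (reflexive (≡.cong (z ^ᵗ_) (m∸n+n≡m m≤n)))) ⟩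
    (z ^ᵗ n) * (con c + z * s)
      ≈⟨ solve 4 (λ p c z s → p :* (c :+ z :* s) := c :* p :+ (z :* p) :* s) refl (z ^ᵗ n) (con c) z s ⟩
    con c * (z ^ᵗ n) + (z * (z ^ᵗ n)) * s
      ≈⟨ +-congˡ (trans (*-congʳ (gen top)) (zeroˡ s)) ⟩
    con c * (z ^ᵗ n) + 0#
      ≈⟨ +-identityʳ _ ⟩
    con c * (z ^ᵗ n) ∎

-- Evaluation at Z as an isomorphism onto the invariants.

module Embedding (n : ℕ) where
  open ℚ-Algebra (VG-algebra n) hiding (zero)
  open Relations n
  open Action n
  open Spanning n
  open Exp semiring using (_^_; ^-congˡ)
  open Mult semiring using () renaming (_×_ to _·_)
  open Sum semiring using (sum; sum-remove)
  private
    module T = Truncated n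
    module Model = Evaluation (D n) (λ (p : Pair n) → ψ n (Pair.fst p) (Pair.snd p))
    module Dn = ℚ-Algebra (D n)
    module DSum = Sum Dn.semiring
    module DExp = Exp Dn.semiring

  ⟦z^⟧ : ∀ k → ⟦ z ^ᵗ k ⟧ ≡ Z ^ k
  ⟦z^⟧ zero    = ≡.refl
  ⟦z^⟧ (suc k) = ≡.cong (Z ⊗_) (⟦z^⟧ k)

  -- Of the n+1 summands of Z, the one at last is 0.
  Z-nilpotent : Z ^ suc n ≈ 0#
  Z-nilpotent = trans (^-congˡ (suc n) (trans (sum-remove {i = last} (X last))
      (trans (+-congʳ (reflexive (X-diag last))) (+-identityˡ _))))
    (SquareZero.sum-nilpotent commutativeRing n _ (λ i → X-sq last (punchIn last i)))

  trunc-vanish : ∀ {g} → TruncGen n g → ⟦ g ⟧ ≈ 0#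
  trunc-vanish top = trans (reflexive (⟦z^⟧ (suc n))) Z-nilpotent

  embed-cong : ∀ {s t} → s T.≈ t → ⟦ s ⟧ ≈ ⟦ t ⟧
  embed-cong = ⟦⟧-cong trunc-vanish

  model-vanish : ∀ {g} → VGGen n g → Model.⟦ g ⟧ Dn.≈ Dn.0#
  model-vanish (sq i j d)        = ψ-sq n i j
  model-vanish (anti i j d d′)   = ψ-anti n i j
  model-vanish (tri i j k d e f) = ψ-tri n i j k d e f

  model-X : ∀ i j → Model.⟦ X i j ⟧ Dn.≈ ψ n i j
  model-X i j with i ≟ j
  ... | yes ≡.refl = Dn.trans Dn.κ-0 (Dn.sym (ψ-diag n i))
  ... | no _       = Dn.refl

  model-sum : ∀ {m} (f : Fin m → Carrier) → Model.⟦ sum f ⟧ Dn.≈ DSum.sum (Model.⟦_⟧ ∘ f)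
  model-sum {zero}  f = Dn.κ-0
  model-sum {suc m} f = Dn.+-congˡ (model-sum (f ∘ suc))

  model-Z^ : ∀ k → Model.⟦ Z ^ k ⟧ Dn.≈ ζ n DExp.^ k
  model-Z^ zero    = Dn.κ-1
  model-Z^ (suc k) = Dn.*-cong (Dn.trans (model-sum (X last)) (DSum.sum-cong-≋ (model-X last))) (model-Z^ k)

  -- The map to `D n` sends the hypothesis to that of `ζⁿ-free`.
  Zⁿ-free : ∀ c → con c * Z ^ n ≈ 0# → c ≡ 0ℚ
  Zⁿ-free c e = ζⁿ-free n c (Dn.trans (Dn.*-congˡ (Dn.sym (model-Z^ n)))
    (Dn.trans (Model.⟦⟧-cong model-vanish e) Dn.κ-0))

  -- Multiplying by z^(n-m) isolates the lowest coefficient `c` by `leading-term`, and `Zⁿ-free`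
  -- makes it zero. Then z^m t = z^(m+1) s, and the argument repeats with `s`; beyond degree n the
  -- power of `z` itself vanishes.
  z^-injective : ∀ {t} → T.Horner t → ∀ m → ⟦ (z ^ᵗ m) ⊗ t ⟧ ≈ 0# → (z ^ᵗ m) T.* t T.≈ T.0#
  z^-injective (T.nil e) m _ = T.trans (T.*-congˡ e) (T.zeroʳ _)
  z^-injective {t} (T.cons c {s} e h) m p with m ≤? n
  ... | no m≰n  = T.trans (T.*-congʳ (T.z^-vanish m (≰⇒> m≰n))) (T.zeroˡ _)
  ... | yes m≤n = T.trans shift (z^-injective h (suc m) (trans (embed-cong (T.sym shift)) p))
    where
    c≡0 : c ≡ 0ℚ
    c≡0 = Zⁿ-free c (begin
      con c * Z ^ n                                      ≡⟨ ≡.cong (con c ⊗_) (⟦z^⟧ n) ⟨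
      ⟦ con c ⊗ (z ^ᵗ n) ⟧                               ≈⟨ embed-cong (T.leading-term m m≤n c s) ⟨
      ⟦ (z ^ᵗ (n ℕ.∸ m)) ⊗ ((z ^ᵗ m) ⊗ (con c ⊕ z ⊗ s)) ⟧ ≈⟨ *-congˡ (*-congˡ (embed-cong (T.sym e))) ⟩
      ⟦ z ^ᵗ (n ℕ.∸ m) ⟧ * ⟦ (z ^ᵗ m) ⊗ t ⟧               ≈⟨ *-congˡ p ⟩
      ⟦ z ^ᵗ (n ℕ.∸ m) ⟧ * 0#                             ≈⟨ zeroʳ _ ⟩
      0#                                                  ∎)
      where open SetoidReasoning setoid

    shift : (z ^ᵗ m) T.* t T.≈ (z ^ᵗ suc m) T.* s
    shift = T.trans (T.*-congˡ (T.trans e (T.trans (T.+-congʳ (T.reflexive (≡.cong con c≡0))) (T.+-identityˡ _))))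
      (T.trans (T.sym (T.*-assoc _ _ _)) (T.*-congʳ (T.*-comm _ _)))

  embed-injective : ∀ s t → ⟦ s ⟧ ≈ ⟦ t ⟧ → s T.≈ t
  embed-injective s t e = T.trans (RingProperties.+-inverseˡ-unique T.ring s (⊝ t) difference)
    (RingProperties.-‿involutive T.ring t)
    where
    difference : s T.+ (⊝ t) T.≈ T.0#
    difference = T.trans (T.sym (T.*-identityˡ _)) (z^-injective (T.horner (s ⊕ (⊝ t))) 0
      (trans (*-identityˡ _) (trans (+-congʳ e) (-‿inverseʳ _))))

  -- `reduce` starts at `last` with coefficient 1 and all other points free, so the paths it asks
  -- for are those of `Good-path`.
  all-Good : ∀ t → Good t
  all-Good t = Good-≈ (sym (*-identityˡ t))
    (reduce (length R) R ≤-refl last 1# t (without-∌ {R = allFin (suc n)}) (without-∌ {R = allFin (suc n)}) tt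
      (Over-all (λ i → without-cover (∈-allFin i)) t)
      λ ws u _ → Good-≈ (*-identityˡ _) (Good-path ws u))
    where R = without last (allFin (suc n))

  unscale : ∀ m → 1 ≤ m → ∀ {a} → (∃ λ p → m · a ≈ ⟦ p ⟧) → ∃ λ p → ⟦ p ⟧ ≈ a
  unscale (suc k) _ (p , e) = con (recip k) ⊗ p , sym (Division.divide (VG-algebra n) k e)

  abstract
    -- For invariant `a`, `Sym a` is n! times `a`, and `all-Good` makes it a polynomial in `Z`.
    embed-surjective : ∀ {a} → Invariant n a → ∃ λ p → ⟦ p ⟧ ≈ a
    embed-surjective {a} inv = unscale (n !) (1≤n! n)
      (proj₁ (all-Good a) , trans (sym (Symmetrisation.Sym-invariant n inv)) (proj₂ (all-Good a)))

theorem1p1 : (n : ℕ) → n ≥ 2 →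
    ∃ λ f → RingMorphisms.IsRingIsomorphism (VGInv n) (Trunc n) f
-- `f` inverts evaluation at `Z`. Each homomorphism law is checked after evaluating:
-- `embed-injective` reduces it to an identity in VG_n, where `f-inverse` removes every `f`.
theorem1p1 n _ = f , record
  { isRingMonomorphism = record
    { isRingHomomorphism = record
      { isSemiringHomomorphism = record
        { isNearSemiringHomomorphism = record
          { +-isMonoidHomomorphism = record
            { isMagmaHomomorphism = record
              { isRelHomomorphism = record
                { cong = λ {a} {b} e → embed-injective _ _ (trans (f-inverse a) (trans e (sym (f-inverse b)))) }
              ; homo = λ a b → embed-injective _ _
                  (trans (f-inverse (a Inv.+ b)) (sym (+-cong (f-inverse a) (f-inverse b)))) }
            ; ε-homo = embed-injective _ _ (f-inverse Inv.0#) }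
          ; *-homo = λ a b → embed-injective _ _
              (trans (f-inverse (a Inv.* b)) (sym (*-cong (f-inverse a) (f-inverse b)))) }
        ; 1#-homo = embed-injective _ _ (f-inverse Inv.1#) }
      ; -‿homo = λ a → embed-injective _ _ (trans (f-inverse (Inv.- a)) (sym (-‿cong (f-inverse a)))) }
    ; injective = λ {a} {b} e → trans (sym (f-inverse a)) (trans (embed-cong e) (f-inverse b)) }
  ; surjective = λ p → (⟦ p ⟧ , ⟦⟧-invariant p) , λ {a} e → embed-injective _ _ (trans (f-inverse a) e) }
  where
  open ℚ-Algebra (VG-algebra n) hiding (zero)
  open Spanning n
  open Embedding n
  module Inv = RawRing (VGInv n)

  f : Inv.Carrier → Term ⊤
  f (a , inv) = proj₁ (embed-surjective inv)

  f-inverse : ∀ a → ⟦ f a ⟧ ≈ proj₁ a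
  f-inverse (a , inv) = proj₂ (embed-surjective inv)
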